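{- Let $\phi$ be a first-order formula over the vocabulary $\{\subseteq,\preceq\}$. Then $\textsc{Eval}(\phi)$ is in $\mathrm{P}$.
   Context: A partial instance of dimension $n$ is a tuple in $\{0,1,\bot\}^n$; write $\mathbf{e}_\bot=\{i\mid\mathbf{e}[i]=\bot\}$. For a decision tree $\mathcal{T}$ of dimension $n$ (a rooted binary tree with internal nodes labeled by features in $\{1,\dots,n\}$, edges labeled $0/1$, leaves labeled $\mathsf{true}/\mathsf{false}$, no feature repeated on a root-to-leaf path), formulas over $\{\subseteq,\preceq\}$ are interpreted over the domain $\{0,1,\bot\}^n$ where $\mathbf{e}_1\subseteq\mathbf{e}_2$ iff $\mathbf{e}_1[i]=\mathbf{e}_2[i]$ for every $i$ with $\mathbf{e}_1[i]\neq\bot$ (subsumption), and $\mathbf{e}\preceq\mathbf{e}'$ iff $|\mathbf{e}_\bot|\ge|\mathbf{e}'_\bot|$. For a fixed formula $\phi(x_1,\dots,x_k)$, $\textsc{Eval}(\phi)$ takes as input a decision tree $\mathcal{T}$ of dimension $n$ and partial instances $\mathbf{e}_1,\dots,\mathbf{e}_k$ of dimension $n$ and asks whether $\mathcal{T}\models\phi(\mathbf{e}_1,\dots,\mathbf{e}_k)$. -}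

module Defs where

open import Data.Nat using (ℕ; zero; suc; _+_; _*_; _^_; _≥_)
open import Data.Fin using (Fin; toℕ)
open import Data.Bool using (Bool; true; false)
open import Data.List using (List; []; _∷_; _++_; replicate; length; map)
open import Data.List.Membership.Propositional using (_∈_)
open import Data.Vec using (Vec; []; _∷_; lookup; toList)
open import Data.Product using (Σ; ∃; _×_; _,_)
open import Data.Sum using (_⊎_)
open import Relation.Nullary using (¬_)
open import Data.Unit using (⊤)
open import Relation.Binary.PropositionalEquality using (_≡_; _≢_)
open import Function.Bundles using (_⇔_)

data Val : Set where
  v0 v1 bot : Val

PInst : ℕ → Set
PInst n = Vec Val n

countBot : ∀ {n} → PInst n → ℕ
countBot [] = 0
countBot (bot ∷ e) = suc (countBot e)
countBot (v0 ∷ e) = countBot e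
countBot (v1 ∷ e) = countBot e

_⊑_ : ∀ {n} → PInst n → PInst n → Set
_⊑_ {n} e₁ e₂ = (i : Fin n) → lookup e₁ i ≢ bot → lookup e₁ i ≡ lookup e₂ i

_≼_ : ∀ {n} → PInst n → PInst n → Set
e ≼ e' = countBot e ≥ countBot e'

data DTree (n : ℕ) : Set where
  leaf : Bool → DTree n
  node : Fin n → DTree n → DTree n → DTree n   -- node i t₀ t₁ : 0-edge to t₀, 1-edge to t₁

NoRepeatFrom : ∀ {n} → List (Fin n) → DTree n → Set
NoRepeatFrom used (leaf _) = ⊤
NoRepeatFrom used (node i t₀ t₁) =
  ¬ (i ∈ used) × NoRepeatFrom (i ∷ used) t₀ × NoRepeatFrom (i ∷ used) t₁

ValidTree : ∀ {n} → DTree n → Set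
ValidTree t = NoRepeatFrom [] t

data Formula : ℕ → Set where
  sub  : ∀ {k} → Fin k → Fin k → Formula k
  pre  : ∀ {k} → Fin k → Fin k → Formula k
  eq   : ∀ {k} → Fin k → Fin k → Formula k
  neg  : ∀ {k} → Formula k → Formula k
  conj : ∀ {k} → Formula k → Formula k → Formula k
  disj : ∀ {k} → Formula k → Formula k → Formula k
  ex   : ∀ {k} → Formula (suc k) → Formula k
  all  : ∀ {k} → Formula (suc k) → Formula k

Sat : ∀ {n k} → Formula k → Vec (PInst n) k → Set
Sat (sub x y) ρ = lookup ρ x ⊑ lookup ρ y
Sat (pre x y) ρ = lookup ρ x ≼ lookup ρ y
Sat (eq x y) ρ = lookup ρ x ≡ lookup ρ y
Sat (neg φ) ρ = ¬ Sat φ ρ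
Sat (conj φ ψ) ρ = Sat φ ρ × Sat ψ ρ
Sat (disj φ ψ) ρ = Sat φ ρ ⊎ Sat ψ ρ
Sat {n} (ex φ) ρ = Σ (PInst n) λ e → Sat φ (e ∷ ρ)
Sat {n} (all φ) ρ = (e : PInst n) → Sat φ (e ∷ ρ)

-- T ⊨ φ(e₁,…,e_k)   (T only fixes the dimension n of the domain)
_⊨_[_] : ∀ {n k} → DTree n → Formula k → Vec (PInst n) k → Set
T ⊨ φ [ es ] = Sat φ es

data Sym : Set where
  s0 s1 s⊥ sep lf lt nd : Sym

unary : ℕ → List Sym
unary m = replicate m s1

encVal : Val → Sym
encVal v0 = s0
encVal v1 = s1
encVal bot = s⊥

encPInst : ∀ {n} → PInst n → List Sym
encPInst [] = []
encPInst (v ∷ e) = encVal v ∷ encPInst e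

encTree : ∀ {n} → DTree n → List Sym
encTree (leaf false) = lf ∷ []
encTree (leaf true) = lt ∷ []
encTree (node i t₀ t₁) = nd ∷ unary (toℕ i) ++ sep ∷ encTree t₀ ++ encTree t₁

encPInsts : ∀ {n k} → Vec (PInst n) k → List Sym
encPInsts [] = []
encPInsts (e ∷ es) = sep ∷ encPInst e ++ encPInsts es

encInput : ∀ {n k} → DTree n → Vec (PInst n) k → List Sym
encInput {n} T es = unary n ++ sep ∷ encTree T ++ encPInsts es

data Move : Set where
  L R S : Move

data Action (Q Γ : ℕ) : Set where
  halt : Bool → Action Q Γ
  go   : Fin Q → Fin Γ → Move → Action Q Γ

record TM : Set where
  field
    Q     : ℕ
    Γ     : ℕ
    blank : Fin Γ
    inp   : Sym → Fin Γ
    start : Fin Q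
    δ     : Fin Q → Fin Γ → Action Q Γ

record Config (M : TM) : Set where
  constructor conf
  field
    state : Fin (TM.Q M)
    left  : List (Fin (TM.Γ M))    -- cells to the left of the head, nearest first
    head  : Fin (TM.Γ M)
    right : List (Fin (TM.Γ M))

data Status (M : TM) : Set where
  running : Config M → Status M
  halted  : Bool → Status M

moveHead : (M : TM) → Fin (TM.Q M) → Fin (TM.Γ M) → Move →
           List (Fin (TM.Γ M)) → List (Fin (TM.Γ M)) → Config M
moveHead M q a S ls rs = conf q ls a rs
moveHead M q a L [] rs = conf q [] a rs
moveHead M q a L (l ∷ ls) rs = conf q ls l (a ∷ rs)
moveHead M q a R ls [] = conf q (a ∷ ls) (TM.blank M) []
moveHead M q a R ls (r ∷ rs) = conf q (a ∷ ls) r rs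

step : (M : TM) → Config M → Status M
step M (conf q ls h rs) with TM.δ M q h
... | halt b = halted b
... | go q' a m = running (moveHead M q' a m ls rs)

run : (M : TM) → ℕ → Status M → Status M
run M zero s = s
run M (suc t) (halted b) = halted b
run M (suc t) (running c) = run M t (step M c)

initConfig : (M : TM) → List Sym → Config M
initConfig M [] = conf (TM.start M) [] (TM.blank M) []
initConfig M (x ∷ w) = conf (TM.start M) [] (TM.inp M x) (map (TM.inp M) w)

EvalInP : ∀ {k} → Formula k → Set
EvalInP {k} φ =
  Σ TM λ M → Σ ℕ λ c →
    (n : ℕ) (T : DTree n) → ValidTree T → (es : Vec (PInst n) k) →
      let w = encInput T es in
      Σ Bool λ b →
        (run M (c * (suc (length w)) ^ c) (running (initConfig M w)) ≡ halted b)
        × ((b ≡ true) ⇔ (T ⊨ φ [ es ]))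

{-# OPTIONS --safe #-}
module Submission where

open import Defs
open import Algebra.Properties.CommutativeSemigroup using (x∙yz≈y∙xz)
open import Data.Bool using (Bool; true; false; if_then_else_; not; _∧_; T)
open import Data.Bool.Properties using (∧-comm; ∧-identityʳ)
open import Data.Empty using (⊥-elim)
open import Data.Fin using (Fin; zero; suc)
open import Data.List using (List; []; _∷_; _++_; _∷ʳ_; concatMap; deduplicate; length; map; replicate)
import Data.List as List
open import Data.List.Membership.Propositional using (_∈_; _∉_)
open import Data.List.Membership.Propositional.Properties using (∈-map⁺; ∈-map⁻; ∈-++⁺ˡ; ∈-++⁺ʳ; ∈-++⁻; ∈-concatMap⁺; ∈-deduplicate⁺; ∈-deduplicate⁻)
open import Data.List.Properties using (++-assoc; ++-identityʳ; ∷ʳ-++; ∷-injective; map-++; map-∘; map-id; length-map; length-++)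
open import Data.List.Relation.Binary.Permutation.Propositional as Perm using (_↭_; ↭-refl; ↭-sym; ↭-trans; prep; swap)
open import Data.List.Relation.Binary.Permutation.Propositional.Properties using (shift; drop-∷; ↭-map-inv; All-resp-↭; ∈-resp-↭) renaming (map⁺ to ↭-map⁺)
open import Data.List.Relation.Binary.Pointwise using (Pointwise; []; _∷_)
open import Data.List.Relation.Unary.All as All using (All; []; _∷_)
open import Data.List.Relation.Unary.All.Properties using (++⁺; map⁺; replicate⁺)
open import Data.List.Relation.Unary.AllPairs using ([]; _∷_)
open import Data.List.Relation.Unary.Any as Any using (here; there; index)
open import Data.List.Relation.Unary.Any.Properties using (lookup-index)
open import Data.List.Relation.Unary.Unique.DecPropositional.Properties using (deduplicate-!)
open import Data.List.Relation.Unary.Unique.Propositional using (Unique)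
open import Data.List.Reverse using (Reverse; []; _∶_∶ʳ_; reverseView)
open import Data.Maybe using (Maybe; just; nothing; maybe′; _>>=_)
open import Data.Nat using (ℕ; zero; suc; _+_; _*_; _^_; _⊔_; _≤_; z≤n; s≤s; s≤s⁻¹)
open import Data.Nat.Properties
open import Data.Product using (Σ; ∃; _×_; _,_; proj₁; proj₂; map₂)
open import Data.Sum using (_⊎_; inj₁; inj₂; [_,_]′)
open import Data.Unit using (⊤; tt)
open import Data.Vec as Vec using (Vec; []; _∷_; lookup; toList; zipWith; head; tail)
open import Data.Vec.Properties using (≡-dec; lookup-map; ∷-injectiveˡ; ∷-injectiveʳ)
open import Function using (_∘_; id; const)
open import Function.Bundles using (_⇔_; mk⇔)
open import Relation.Binary.Construct.Closure.ReflexiveTransitive using (Star; ε; _◅_; gmap)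
open import Relation.Binary.PropositionalEquality using (_≡_; _≢_; refl; sym; trans; cong; cong₂; subst; subst₂)
open import Relation.Nullary using (¬_; Dec; yes; no; does)
open import Relation.Nullary.Decidable using (dec-true; dec-false; isYes; toWitness; fromWitness; ¬?; _→-dec_)
open import Relation.Nullary.Reflects using (Reflects; ofʸ; ofⁿ; ¬-reflects; _×-reflects_; _⊎-reflects_; invert)

-- Sat φ depends on an assignment ρ of k instances only through the multiset of its n columns in
-- {0,1,⊥}^k.  Quantifying over a further instance amounts to choosing, for every column type u,
-- how many of the columns u become 0u, 1u and ⊥u: polynomially many choices, which a machine can
-- enumerate in nested loops by rewriting one column at a time.  The atoms are decided by a single
-- sweep, or (for ≼) by cancelling ⊥s of one row against ⊥s of the other.

-- The obstacle is that a choice has to be made, evaluated and undone in place, on one tape, over an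
-- alphabet fixed by `φ`. Hence no counters are stored: the count of a type is the number of its
-- columns on the tape, a column never leaves its cell, and every decision procedure hands back the
-- word it received, so that it can be run again inside another search. A new row starts as all ⊥.
-- Only the types with head 0 or 1 need a loop, because whatever is not rewritten is the ⊥ part. A
-- quantifier over columns of length k thus costs 2·3^k nested loops of at most N + 1 rounds, with N
-- the length of the word on the tape. The degree is large but depends on `φ` alone. Invariance
-- under permutation is used twice: it makes the choice of the rewritten column irrelevant, and it
-- turns a multiset of columns found by the search back into an actual row. A universal quantifier
-- is run as ¬∃¬, which is constructively sound because its body is already decided.

private
  variable
    A B C X Y St : Set
    k m : ℕ

-- Finite types and polynomial bounds

-- Repetitions in the listing are allowed, which keeps the notion closed under surjections; the
-- machines only require that `decode` undoes `code`.
Finite : Set → Set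
Finite A = Σ (List A) λ xs → ∀ a → a ∈ xs

⊤-finite : Finite ⊤
⊤-finite = tt ∷ [] , λ _ → here refl

Bool-finite : Finite Bool
Bool-finite = true ∷ false ∷ [] , λ { true → here refl ; false → there (here refl) }

Val-finite : Finite Val
Val-finite = v0 ∷ v1 ∷ bot ∷ [] ,
  λ { v0 → here refl ; v1 → there (here refl) ; bot → there (there (here refl)) }

Sym-finite : Finite Sym
Sym-finite = s0 ∷ s1 ∷ s⊥ ∷ sep ∷ lf ∷ lt ∷ nd ∷ [] ,
  λ { s0 → here refl ; s1 → there (here refl) ; s⊥ → there (there (here refl))
    ; sep → there (there (there (here refl))) ; lf → there (there (there (there (here refl))))
    ; lt → there (there (there (there (there (here refl)))))
    ; nd → there (there (there (there (there (there (here refl)))))) }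

⊎-finite : Finite A → Finite B → Finite (A ⊎ B)
⊎-finite (xs , xs-all) (ys , ys-all) = map inj₁ xs ++ map inj₂ ys ,
  λ { (inj₁ a) → ∈-++⁺ˡ (∈-map⁺ inj₁ (xs-all a))
    ; (inj₂ b) → ∈-++⁺ʳ (map inj₁ xs) (∈-map⁺ inj₂ (ys-all b)) }

Σ-finite : {F : A → Set} → Finite A → (∀ a → Finite (F a)) → Finite (Σ A F)
Σ-finite {F = F} (xs , xs-all) fin = concatMap fibre xs , λ { (a , b) →
    ∈-concatMap⁺ fibre (Any.map (λ { refl → ∈-map⁺ (a ,_) (proj₂ (fin a) b) }) (xs-all a)) }
  where
  fibre : ∀ a → List (Σ _ F)
  fibre a = map (a ,_) (proj₁ (fin a))

×-finite : Finite A → Finite B → Finite (A × B)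
×-finite finA finB = Σ-finite finA (λ _ → finB)

Maybe-finite : Finite A → Finite (Maybe A)
Maybe-finite (xs , xs-all) = nothing ∷ map just xs ,
  λ { nothing → here refl ; (just a) → there (∈-map⁺ just (xs-all a)) }

surjection-finite : (f : A → B) (g : B → A) → (∀ b → f (g b) ≡ b) → Finite A → Finite B
surjection-finite f g fg (xs , xs-all) = map f xs , λ b →
  subst (_∈ map f xs) (fg b) (∈-map⁺ f (xs-all (g b)))

Vec-finite : Finite A → ∀ k → Finite (Vec A k)
Vec-finite fin zero = [] ∷ [] , λ { [] → here refl }
Vec-finite fin (suc k) =
  surjection-finite (λ (a , v) → a ∷ v) (λ { (a ∷ v) → a , v }) (λ { (a ∷ v) → refl })
    (×-finite fin (Vec-finite fin k))

code : (fin : Finite A) → A → Fin (length (proj₁ fin))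
code (xs , xs-all) a = index (xs-all a)

decode : (fin : Finite A) → Fin (length (proj₁ fin)) → A
decode (xs , _) = List.lookup xs

decode-code : (fin : Finite A) (a : A) → decode fin (code fin a) ≡ a
decode-code (xs , xs-all) a = sym (lookup-index (xs-all a))

-- A single `c` is both factor and exponent because `EvalInP` asks for this form. With base `suc N`
-- powers grow with the exponent, so `c` can be enlarged freely.
Poly : (ℕ → ℕ) → Set
Poly T = Σ ℕ λ c → ∀ N → T N ≤ c * suc N ^ c

poly-const : ∀ d → Poly (λ _ → d)
poly-const d = d , λ N → m≤m*n d (suc N ^ d) {{m^n≢0 (suc N) d}}

poly-id : Poly (λ N → N)
poly-id = 1 , λ N → ≤-trans (n≤1+n N)
  (≤-reflexive (sym (trans (*-identityˡ _) (*-identityʳ (suc N)))))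

poly-+ : ∀ {T U} → Poly T → Poly U → Poly (λ N → T N + U N)
poly-+ (c , p) (d , q) = c + d , λ N →
  ≤-trans (+-mono-≤ (≤-trans (p N) (*-monoʳ-≤ c (^-monoʳ-≤ (suc N) (m≤m+n c d))))
                    (≤-trans (q N) (*-monoʳ-≤ d (^-monoʳ-≤ (suc N) (m≤n+m d c)))))
          (≤-reflexive (sym (*-distribʳ-+ (suc N ^ (c + d)) c d)))

poly-* : ∀ {T U} → Poly T → Poly U → Poly (λ N → T N * U N)
poly-* {T} {U} (c , p) (d , q) = e , λ N → let s = suc N in begin
  T N * U N                     ≤⟨ *-mono-≤ (p N) (q N) ⟩
  (c * s ^ c) * (d * s ^ d)     ≡⟨ [m*n]*[o*p]≡[m*o]*[n*p] c (s ^ c) d (s ^ d) ⟩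
  (c * d) * (s ^ c * s ^ d)     ≡⟨ cong (c * d *_) (sym (^-distribˡ-+-* s c d)) ⟩
  (c * d) * s ^ (c + d)         ≤⟨ *-mono-≤ (m≤m+n (c * d) (c + d)) (^-monoʳ-≤ s (m≤n+m (c + d) (c * d))) ⟩
  e * s ^ e                     ∎
  where
  open ≤-Reasoning
  -- `e` has to dominate the factor `c * d` and the exponent `c + d` at once.
  e = c * d + (c + d)

-- Machines with exit values

-- The flag marks the leftmost cell of the tape; nothing is the blank.
Cell : Set → Set
Cell A = Maybe (Bool × A)

plain : A → Cell A
plain a = just (false , a)

record Tape (A : Set) : Set where
  constructor tape
  field
    left  : List (Cell A)
    scan  : Cell A
    right : List (Cell A)

-- The clauses copy those of `moveHead`, including the left move at the left end, which stays put;
-- this makes `moveHead-slide` hold by `refl`.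
slide : Move → Cell A → List (Cell A) → List (Cell A) → Tape A
slide S a ls       rs       = tape ls a rs
slide L a []       rs       = tape [] a rs
slide L a (l ∷ ls) rs       = tape ls l (a ∷ rs)
slide R a ls       []       = tape (a ∷ ls) nothing []
slide R a ls       (r ∷ rs) = tape (a ∷ ls) r rs

record Mach (A X : Set) : Set₁ where
  field
    State  : Set
    finite : Finite State
    start  : State
    δ      : State → Cell A → Cell A × Move × (State ⊎ X)
open Mach

data Exec (M : Mach A X) : State M → Tape A → ℕ → X → Tape A → Set where
  exit : ∀ {q ls h rs a m x} → δ M q h ≡ (a , m , inj₂ x) →
         Exec M q (tape ls h rs) 1 x (slide m a ls rs)
  next : ∀ {q ls h rs a m q' t x τ} → δ M q h ≡ (a , m , inj₁ q') →
         Exec M q' (slide m a ls rs) t x τ → Exec M q (tape ls h rs) (suc t) x τ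

ret : X → Mach A X
ret x = record { State = ⊤ ; finite = ⊤-finite ; start = tt ; δ = λ _ a → a , S , inj₂ x }

continue : {Q Q' : Set} → (Q → Q') → (X → Q' ⊎ Y) → Cell A × Move × (Q ⊎ X) → Cell A × Move × (Q' ⊎ Y)
continue f k (a , m , r) = a , m , [ inj₁ ∘ f , k ]′ r

-- The exit value becomes part of the control state, hence `Finite X`. The exiting step of `M` is
-- itself the jump into `N x`, so running times add without overhead.
bind : Finite X → Mach A X → (X → Mach A Y) → Mach A Y
bind fin M N = record
  { State  = State M ⊎ Σ _ (State ∘ N)
  ; finite = ⊎-finite (finite M) (Σ-finite fin (finite ∘ N))
  ; start  = inj₁ (start M)
  ; δ      = λ { (inj₁ q) h       → continue inj₁ (λ x → inj₁ (inj₂ (x , start (N x)))) (δ M q h)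
               ; (inj₂ (x , q)) h → continue (λ q' → inj₂ (x , q')) inj₂ (δ (N x) q h) } }

loop : Mach A (Maybe X) → Mach A X
loop M = record
  { State  = State M
  ; finite = finite M
  ; start  = start M
  ; δ      = λ q h → continue id (maybe′ inj₂ (inj₁ (start M))) (δ M q h) }

module _ (fin : Finite X) (M : Mach A X) (N : X → Mach A Y) where

  exec-bindʳ : ∀ {x q τ t y τ'} → Exec (N x) q τ t y τ' → Exec (bind fin M N) (inj₂ (x , q)) τ t y τ'
  exec-bindʳ (exit e)   = exit (cong (continue _ _) e)
  exec-bindʳ (next e p) = next (cong (continue _ _) e) (exec-bindʳ p)

  exec-bind : ∀ {q τ t x τ' t' y τ''} → Exec M q τ t x τ' → Exec (N x) (start (N x)) τ' t' y τ'' →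
              Exec (bind fin M N) (inj₁ q) τ (t + t') y τ''
  exec-bind (exit e)   r = next (cong (continue _ _) e) (exec-bindʳ r)
  exec-bind (next e p) r = next (cong (continue _ _) e) (exec-bind p r)

module _ (M : Mach A (Maybe X)) where

  exec-loop-done : ∀ {q τ t x τ'} → Exec M q τ t (just x) τ' → Exec (loop M) q τ t x τ'
  exec-loop-done (exit e)   = exit (cong (continue _ _) e)
  exec-loop-done (next e p) = next (cong (continue _ _) e) (exec-loop-done p)

  exec-loop-again : ∀ {q τ t τ' t' x τ''} → Exec M q τ t nothing τ' →
                    Exec (loop M) (start M) τ' t' x τ'' → Exec (loop M) q τ (t + t') x τ''
  exec-loop-again (exit e)   r = next (cong (continue _ _) e) r
  exec-loop-again (next e p) r = next (cong (continue _ _) e) (exec-loop-again p r)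

-- Two-way sweeps over the tape

mapAccumL : (St → A → St × A) → St → List A → St × List A
mapAccumL f s []       = s , []
mapAccumL f s (x ∷ xs) = let s₁ , y = f s x ; s₂ , ys = mapAccumL f s₁ xs in s₂ , y ∷ ys

mapAccumR : (St → A → St × A) → St → List A → St × List A
mapAccumR g s []       = s , []
mapAccumR g s (x ∷ xs) = let s₁ , ys = mapAccumR g s xs ; s₂ , y = g s₁ x in s₂ , y ∷ ys

-- The normal form between subroutines: the head on the first cell, which carries the flag if the
-- word is nonempty, and one blank behind the word. Runs between such tapes compose without
-- repositioning the head.
onTape : List A → Tape A
onTape []       = tape [] nothing []
onTape (x ∷ xs) = tape [] (just (true , x)) (map plain xs ++ nothing ∷ [])

record Runs (M : Mach A X) (w : List A) (T : ℕ) (x : X) (w' : List A) : Set where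
  constructor runs
  field
    {steps} : ℕ
    bounded : steps ≤ T
    exec    : Exec M (start M) (onTape w) steps x (onTape w')

module _ (fin : Finite St) (f g : St → A → St × A) where

  sweep : St → Mach A St
  sweep s₀ = record
    { State = St ⊎ St ; finite = ⊎-finite fin fin ; start = inj₁ s₀
    ; δ = λ { (inj₁ s) nothing        → nothing , L , inj₁ (inj₂ s)
            ; (inj₁ s) (just (m , a)) → let s' , a' = f s a in just (m , a') , R , inj₁ (inj₁ s')
            -- Reached only on the empty word, where the preceding left move had nowhere to go and
            -- stayed on the blank.
            ; (inj₂ s) nothing        → nothing , S , inj₂ s
            ; (inj₂ s) (just (true , a))  → let s' , a' = g s a in just (true , a') , S , inj₂ s'
            ; (inj₂ s) (just (false , a)) → let s' , a' = g s a in just (false , a') , L , inj₁ (inj₂ s') } }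

  sweepResult : St → List A → St × List A
  sweepResult s w = let s₁ , w₁ = mapAccumL f s w in mapAccumR g s₁ w₁

  -- `t` is the length of the run that follows the return. It accumulates as in the recursion of
  -- `exec-excursion`, so that the step counts agree by definition.
  sweepTime : ℕ → ℕ → ℕ
  sweepTime zero    t = suc t
  sweepTime (suc n) t = suc (sweepTime n (suc t))

  sweepTime-≡ : ∀ n t → sweepTime n t ≡ 2 * n + suc t
  sweepTime-≡ zero    t = refl
  sweepTime-≡ (suc n) t = begin-equality
    suc (sweepTime n (suc t))       ≡⟨ cong suc (sweepTime-≡ n (suc t)) ⟩
    suc (2 * n + suc (suc t))       ≡⟨ cong suc (+-suc (2 * n) (suc t)) ⟩
    2 + 2 * n + suc t               ≡⟨ cong (_+ suc t) (sym (*-suc 2 n)) ⟩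
    2 * suc n + suc t               ∎
    where open ≤-Reasoning

  -- No blank has been written behind the input yet, or a sweep has left exactly one there.
  Padding : List (Cell A) → Set
  Padding pad = pad ≡ [] ⊎ pad ≡ nothing ∷ []

  -- Taking the rest of the run, after the return to l, as a hypothesis allows recursion on the
  -- word to the right of l without ever reversing it.
  exec-excursion : ∀ {s₀ pad} → Padding pad → ∀ xs s l ls {t x τ} →
    let s' , ys = sweepResult s xs in
    Exec (sweep s₀) (inj₂ s') (tape ls l (map plain ys ++ nothing ∷ [])) t x τ →
    Exec (sweep s₀) (inj₁ s) (slide R l ls (map plain xs ++ pad)) (sweepTime (length xs) t) x τ
  exec-excursion (inj₁ refl) [] s l ls k = next refl k
  exec-excursion (inj₂ refl) [] s l ls k = next refl k
  exec-excursion p (x ∷ xs) s l ls k =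
    next refl (exec-excursion p xs _ _ (l ∷ ls) (next refl k))

  exec-sweep : ∀ {pad} → Padding pad → ∀ s x xs → let s' , w' = sweepResult s (x ∷ xs) in
    Σ ℕ λ t → t ≤ 2 * length (x ∷ xs) + 2 ×
    Exec (sweep s) (inj₁ s) (tape [] (just (true , x)) (map plain xs ++ pad)) t s' (onTape w')
  exec-sweep p s x xs = _ , bound , next refl (exec-excursion p xs _ _ [] (exit refl))
    where
    bound : suc (sweepTime (length xs) 1) ≤ 2 * suc (length xs) + 2
    bound = ≤-trans (≤-reflexive (cong suc (sweepTime-≡ (length xs) 1)))
      (≤-trans (n≤1+n _) (≤-reflexive (cong (_+ 2) (sym (*-suc 2 (length xs))))))

  runs-sweep : ∀ s w → let s' , w' = sweepResult s w in Runs (sweep s) w (2 * length w + 2) s' w'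
  runs-sweep s []       = runs {steps = 2} ≤-refl (next refl (exit refl))
  runs-sweep s (x ∷ xs) = let _ , p , r = exec-sweep (inj₂ refl) s x xs in runs p r

runs-ret : (x : X) (w : List A) → Runs (ret x) w 1 x w
runs-ret x []      = runs ≤-refl (exit refl)
runs-ret x (_ ∷ _) = runs ≤-refl (exit refl)

runs-bind : (fin : Finite X) (M : Mach A X) (N : X → Mach A Y) → ∀ {w T x w' T' y w''} →
  Runs M w T x w' → Runs (N x) w' T' y w'' → Runs (bind fin M N) w (T + T') y w''
runs-bind fin M N (runs p r) (runs p' r') = runs (+-mono-≤ p p') (exec-bind fin M N r r')

runs-loop-done : (M : Mach A (Maybe X)) → ∀ {w T x w'} → Runs M w T (just x) w' → Runs (loop M) w T x w'
runs-loop-done M (runs p r) = runs p (exec-loop-done M r)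

runs-loop-again : (M : Mach A (Maybe X)) → ∀ {w T w' T' x w''} →
  Runs M w T nothing w' → Runs (loop M) w' T' x w'' → Runs (loop M) w (T + T') x w''
runs-loop-again M (runs p r) (runs p' r') = runs (+-mono-≤ p p') (exec-loop-again M r r')

runs-weaken : {M : Mach A X} → ∀ {w T T' x w'} → T ≤ T' → Runs M w T x w' → Runs M w T' x w'
runs-weaken q (runs p r) = runs (≤-trans p q) r

-- Translation into the prescribed Turing machines

run-halted : (M : TM) → ∀ {b} t {t'} s → t ≤ t' → run M t s ≡ halted b → run M t' s ≡ halted b
run-halted M zero    {zero}  s           p e = e
run-halted M zero    {suc _} (halted _)  p e = e
run-halted M (suc t) {suc _} (halted _)  p e = e
run-halted M (suc t) {suc _} (running c) p e = run-halted M t (step M c) (s≤s⁻¹ p) e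

module _ (finA : Finite A) (input : Sym → A) (M : Mach A Bool) where

  cell-finite : Finite (Cell A)
  cell-finite = Maybe-finite (×-finite Bool-finite finA)

  encQ : State M → Fin (length (proj₁ (finite M)))
  encQ = code (finite M)

  encC : Cell A → Fin (length (proj₁ cell-finite))
  encC = code cell-finite

  toAction : Cell A × Move × (State M ⊎ Bool) → Action _ _
  toAction (a , m , inj₁ q) = go (encQ q) (encC a) m
  toAction (a , m , inj₂ b) = halt b

  toTM : TM
  toTM = record
    { Q = _ ; Γ = _ ; blank = encC nothing ; inp = encC ∘ plain ∘ input ; start = encQ (start M)
    ; δ = λ q a → toAction (δ M (decode (finite M) q) (decode cell-finite a)) }

  encConfig : State M → Tape A → Config toTM
  encConfig q (tape ls h rs) = conf (encQ q) (map encC ls) (encC h) (map encC rs)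

  moveHead-slide : ∀ q a m ls rs →
    moveHead toTM (encQ q) (encC a) m (map encC ls) (map encC rs) ≡ encConfig q (slide m a ls rs)
  moveHead-slide q a S ls       rs      = refl
  moveHead-slide q a L []       rs      = refl
  moveHead-slide q a L (_ ∷ _)  rs      = refl
  moveHead-slide q a R ls       []      = refl
  moveHead-slide q a R ls       (_ ∷ _) = refl

  step-next : ∀ q ls h rs {a m q'} → δ M q h ≡ (a , m , inj₁ q') →
    step toTM (encConfig q (tape ls h rs)) ≡ running (encConfig q' (slide m a ls rs))
  step-next q ls h rs {a} {m} {q'} e
    rewrite decode-code (finite M) q | decode-code cell-finite h | e
    = cong running (moveHead-slide q' a m ls rs)

  step-exit : ∀ q ls h rs {a m b} → δ M q h ≡ (a , m , inj₂ b) →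
    step toTM (encConfig q (tape ls h rs)) ≡ halted b
  step-exit q ls h rs e
    rewrite decode-code (finite M) q | decode-code cell-finite h | e = refl

  run-toTM : ∀ {q τ t b τ'} → Exec M q τ t b τ' → run toTM t (running (encConfig q τ)) ≡ halted b
  run-toTM (exit {q} {ls} {h} {rs} e) = step-exit q ls h rs e
  run-toTM (next {q} {ls} {h} {rs} {t = t} e p) =
    trans (cong (run toTM t) (step-next q ls h rs e)) (run-toTM p)

-- Machines acting on columns

-- In effect a prism. It lets one fixed alphabet hold columns of several arities: a machine written
-- for `B` runs over `A` and passes over the letters without a view.
record Emb (B A : Set) : Set where
  field
    emb      : B → A
    view     : A → Maybe B
    view-emb : ∀ b → view (emb b) ≡ just b
open Emb

Blind : Emb B A → A → Set
Blind E a = view E a ≡ nothing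

_∘ₑ_ : Emb B A → Emb C B → Emb C A
emb (E ∘ₑ F) = emb E ∘ emb F
view (E ∘ₑ F) a = view E a >>= view F
view-emb (E ∘ₑ F) c rewrite view-emb E (emb F c) = view-emb F c

blind-∘ₑ : (E : Emb B A) (F : Emb C B) → ∀ {a} → Blind E a → Blind (E ∘ₑ F) a
blind-∘ₑ E F e rewrite e = refl

-- The junk behind the columns consists of the encoded tree and of deleted symbols.
record Works (E : Emb B A) (M : Mach A X) (T : ℕ → ℕ) (ws : List B) (x : X) (ws' : List B) : Set where
  constructor works
  field
    same-length : length ws' ≡ length ws
    correctly   : ∀ junk → All (Blind E) junk →
      Runs M (map (emb E) ws ++ junk) (T (length ws + length junk)) x (map (emb E) ws' ++ junk)

works-weaken : (E : Emb B A) {M : Mach A X} → ∀ {T T' ws x ws'} → (∀ n → length ws ≤ n → T n ≤ T' n) →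
  Works E M T ws x ws' → Works E M T' ws x ws'
works-weaken E T≤T' (works l r) = works l λ junk bl → runs-weaken (T≤T' _ (m≤m+n _ _)) (r junk bl)

-- Junk invisible to `E` is invisible to `E ∘ₑ F` as well, so a machine built for the narrower
-- embedding keeps its guarantee under the wider one, on words in the image of `emb F`.
works-restrict : (E : Emb B A) (F : Emb C B) {M : Mach A X} → ∀ {T ws x ws'} →
  Works (E ∘ₑ F) M T ws x ws' → Works E M T (map (emb F) ws) x (map (emb F) ws')
works-restrict E F {M} {T} {ws} {x} {ws'} (works l r) = works
  (trans (length-map (emb F) ws') (trans l (sym (length-map (emb F) ws))))
  λ junk bl → subst (λ n → Runs M (map (emb E) (map (emb F) ws) ++ junk) (T (n + length junk)) x _)
    (sym (length-map (emb F) ws))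
    (subst₂ (λ v v' → Runs M (v ++ junk) (T (length ws + length junk)) x (v' ++ junk))
      (map-∘ {g = emb E} {f = emb F} ws) (map-∘ {g = emb E} {f = emb F} ws')
      (r junk (All.map (blind-∘ₑ E F) bl)))

works-ret : (E : Emb B A) (x : X) (ws : List B) → Works E (ret x) (λ _ → 1) ws x ws
works-ret E x ws = works refl λ junk _ → runs-ret x _

-- Rewriting in place keeps the length, so the bound of the second machine is taken at the same `n`
-- as that of the first.
works-bind : (E : Emb B A) (fin : Finite X) (M : Mach A X) (N : X → Mach A Y) → ∀ {T T' ws x ws' y ws''} →
  Works E M T ws x ws' → Works E (N x) T' ws' y ws'' → Works E (bind fin M N) (λ n → T n + T' n) ws y ws''
works-bind E fin M N {T' = T'} (works l r) (works l' r') = works (trans l' l) λ junk bl →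
  runs-bind fin M N (r junk bl)
    (subst (λ n → Runs _ _ (T' (n + length junk)) _ _) l (r' junk bl))

works-loop-done : (E : Emb B A) (M : Mach A (Maybe X)) → ∀ {T ws x ws'} →
  Works E M T ws (just x) ws' → Works E (loop M) T ws x ws'
works-loop-done E M (works l r) = works l λ junk bl → runs-loop-done M (r junk bl)

works-loop-again : (E : Emb B A) (M : Mach A (Maybe X)) → ∀ {T T' ws ws' x ws''} →
  Works E M T ws nothing ws' → Works E (loop M) T' ws' x ws'' → Works E (loop M) (λ n → T n + T' n) ws x ws''
works-loop-again E M {T' = T'} (works l r) (works l' r') = works (trans l' l) λ junk bl →
  runs-loop-again M (r junk bl)
    (subst (λ n → Runs _ _ (T' (n + length junk)) _ _) l (r' junk bl))

passTime : ℕ → ℕ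
passTime n = 2 * n + 2

poly-passTime : Poly passTime
poly-passTime = poly-+ (poly-* (poly-const 2) poly-id) (poly-const 2)

idle : St → A → St × A
idle s a = s , a

mapAccumR-idle : (s : St) (w : List A) → mapAccumR idle s w ≡ (s , w)
mapAccumR-idle s [] = refl
mapAccumR-idle s (x ∷ w) rewrite mapAccumR-idle s w = refl

length-mapAccumL : (f : St → A → St × A) → ∀ s w → length (proj₂ (mapAccumL f s w)) ≡ length w
length-mapAccumL f s []      = refl
length-mapAccumL f s (x ∷ w) = cong suc (length-mapAccumL f _ w)

module _ (E : Emb B A) (fin : Finite St) (f : St → B → St × B) where

  lift : St → A → St × A
  lift s a = maybe′ (λ b → map₂ (emb E) (f s b)) (s , a) (view E a)

  mapAccumL-blind : ∀ s {junk} → All (Blind E) junk → mapAccumL lift s junk ≡ (s , junk)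
  mapAccumL-blind s [] = refl
  mapAccumL-blind s (e ∷ bl) rewrite e | mapAccumL-blind s bl = refl

  mapAccumL-lift : ∀ s ws {junk} → All (Blind E) junk → mapAccumL lift s (map (emb E) ws ++ junk) ≡
    (proj₁ (mapAccumL f s ws) , map (emb E) (proj₂ (mapAccumL f s ws)) ++ junk)
  mapAccumL-lift s [] bl = mapAccumL-blind s bl
  mapAccumL-lift s (b ∷ ws) bl
    rewrite view-emb E b | mapAccumL-lift (proj₁ (f s b)) ws bl = refl

  pass : St → Mach A St
  pass = sweep fin lift idle

  works-pass : ∀ s ws → let s' , ws' = mapAccumL f s ws in Works E (pass s) passTime ws s' ws'
  works-pass s ws = works (length-mapAccumL f s ws) λ junk bl →
    let e = trans (cong (λ (s' , w') → mapAccumR idle s' w') (mapAccumL-lift s ws bl))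
                  (mapAccumR-idle _ _)
    in subst₂ (λ n r → Runs (pass s) (map (emb E) ws ++ junk) (passTime n) (proj₁ r) (proj₂ r))
         (trans (length-++ (map (emb E) ws)) (cong (_+ length junk) (length-map (emb E) ws))) e
         (runs-sweep fin lift idle s (map (emb E) ws ++ junk))

mapPass : Emb B A → (B → B) → Mach A ⊤
mapPass E h = pass E ⊤-finite (λ _ b → tt , h b) tt

works-mapPass : (E : Emb B A) (h : B → B) (ws : List B) → Works E (mapPass E h) passTime ws tt (map h ws)
works-mapPass E h ws = subst (Works E (mapPass E h) passTime ws tt) (result ws) (works-pass E ⊤-finite _ tt ws)
  where
  result : ∀ ws → proj₂ (mapAccumL (λ _ b → tt , h b) tt ws) ≡ map h ws
  result []       = refl
  result (b ∷ ws) = cong (h b ∷_) (result ws)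

-- Counting and replacing letters

tally : (B → Bool) → List B → ℕ
tally p []       = 0
tally p (x ∷ xs) = (if p x then 1 else 0) + tally p xs

tally-≤-length : (p : B → Bool) (xs : List B) → tally p xs ≤ length xs
tally-≤-length p []       = z≤n
tally-≤-length p (x ∷ xs) with p x
... | true  = s≤s (tally-≤-length p xs)
... | false = m≤n⇒m≤1+n (tally-≤-length p xs)

tally-resp-↭ : (p : B → Bool) → ∀ {xs ys} → xs ↭ ys → tally p xs ≡ tally p ys
tally-resp-↭ p Perm.refl = refl
tally-resp-↭ p (prep x e) = cong (_ +_) (tally-resp-↭ p e)
tally-resp-↭ p (swap x y e) = trans
  (x∙yz≈y∙xz +-commutativeSemigroup (if p x then 1 else 0) (if p y then 1 else 0) _)
  (cong (λ n → (if p y then 1 else 0) + ((if p x then 1 else 0) + n)) (tally-resp-↭ p e))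
tally-resp-↭ p (Perm.trans e e') = trans (tally-resp-↭ p e) (tally-resp-↭ p e')

tally-replace : (p : B → Bool) → ∀ xs {l l'} ys → p l ≡ true → p l' ≡ false →
  tally p (xs ++ l ∷ ys) ≡ suc (tally p (xs ++ l' ∷ ys))
tally-replace p xs {l} {l'} ys pl pl'
  rewrite tally-resp-↭ p (shift l xs ys) | tally-resp-↭ p (shift l' xs ys) | pl | pl' = refl

tally-unchanged : (p : B → Bool) → ∀ xs {l l'} ys → p l ≡ false → p l' ≡ false →
  tally p (xs ++ l ∷ ys) ≡ tally p (xs ++ l' ∷ ys)
tally-unchanged p xs {l} {l'} ys pl pl'
  rewrite tally-resp-↭ p (shift l xs ys) | tally-resp-↭ p (shift l' xs ys) | pl | pl' = refl

tally-split : (p q : B → Bool) (xs : List B) →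
  tally p xs ≡ tally (λ x → p x ∧ q x) xs + tally (λ x → p x ∧ not (q x)) xs
tally-split p q [] = refl
tally-split p q (x ∷ xs) with p x | q x
... | false | _     = tally-split p q xs
... | true  | true  = cong suc (tally-split p q xs)
... | true  | false = trans (cong suc (tally-split p q xs)) (sym (+-suc (tally (λ x → p x ∧ q x) xs) _))

tally-cong : {p q : B → Bool} → (∀ x → p x ≡ q x) → ∀ xs → tally p xs ≡ tally q xs
tally-cong e []       = refl
tally-cong e (x ∷ xs) = cong₂ (λ b n → (if b then 1 else 0) + n) (e x) (tally-cong e xs)

tally-map : (p : B → Bool) (f : C → B) (xs : List C) → tally p (map f xs) ≡ tally (p ∘ f) xs
tally-map p f []       = refl
tally-map p f (x ∷ xs) = cong (_ +_) (tally-map p f xs)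

tally≡0⇒∉ : (p : B → Bool) → ∀ {xs x} → tally p xs ≡ 0 → p x ≡ true → x ∉ xs
tally≡0⇒∉ p e px (here refl) rewrite px with () ← e
tally≡0⇒∉ p {y ∷ xs} e px (there i) = tally≡0⇒∉ p (m+n≡0⇒n≡0 (if p y then 1 else 0) e) px i

module _ (p : B → Bool) (h : B → B) where

  replaceFirst : Bool → B → Bool × B
  replaceFirst true  b = true , b
  replaceFirst false b = if p b then (true , h b) else (false , b)

  data Replaced (ws : List B) : Bool × List B → Set where
    none : tally p ws ≡ 0 → Replaced ws (false , ws)
    some : ∀ xs l ys → p l ≡ true → ws ≡ xs ++ l ∷ ys → Replaced ws (true , xs ++ h l ∷ ys)

  mapAccumL-replaceFirst-true : ∀ ws → mapAccumL replaceFirst true ws ≡ (true , ws)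
  mapAccumL-replaceFirst-true []       = refl
  mapAccumL-replaceFirst-true (b ∷ ws) rewrite mapAccumL-replaceFirst-true ws = refl

  replaced : ∀ ws → Replaced ws (mapAccumL replaceFirst false ws)
  replaced [] = none refl
  replaced (b ∷ ws) with p b in e
  ... | true rewrite mapAccumL-replaceFirst-true ws = some [] b ws e refl
  ... | false with mapAccumL replaceFirst false ws | replaced ws
  ...   | _ | none z = none (trans (cong (λ c → (if c then 1 else 0) + tally p ws) e) z)
  ...   | _ | some xs l ys pl refl = some (b ∷ xs) l ys pl refl

  replacePass : Emb B A → Mach A Bool
  replacePass E = pass E Bool-finite replaceFirst false

  works-replacePass : (E : Emb B A) (ws : List B) →
    ∃ λ res → Works E (replacePass E) passTime ws (proj₁ res) (proj₂ res) × Replaced ws res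
  works-replacePass E ws = _ , works-pass E Bool-finite replaceFirst false ws , replaced ws

-- Letters for columns of all arities k, …, k + m.  The flag marks a column as cancelled when
-- the numbers of ⊥ in two rows are compared.
data Alph : ℕ → ℕ → Set where
  col    : Vec Val k → Bool → Alph k m
  deeper : Alph (suc k) m → Alph k (suc m)

Alph-finite : ∀ k m → Finite (Alph k m)
Alph-finite k zero = surjection-finite (λ (u , b) → col u b) (λ { (col u b) → u , b }) (λ { (col u b) → refl })
  (×-finite (Vec-finite Val-finite k) Bool-finite)
Alph-finite k (suc m) = surjection-finite
  [ (λ (u , b) → col u b) , deeper ]′ (λ { (col u b) → inj₁ (u , b) ; (deeper a) → inj₂ a })
  (λ { (col u b) → refl ; (deeper a) → refl })
  (⊎-finite (×-finite (Vec-finite Val-finite k) Bool-finite) (Alph-finite (suc k) m))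

markedₑ : Emb (Vec Val k × Bool) (Alph k m)
markedₑ = record
  { emb      = λ (u , b) → col u b
  ; view     = λ { (col u b) → just (u , b) ; (deeper _) → nothing }
  ; view-emb = λ _ → refl }

-- Outside the comparison of two counts all columns are unmarked, so the flag is fixed to `false`
-- here; `markedₑ` exposes it while a comparison is running.
columnₑ : Emb (Vec Val k) (Alph k m)
columnₑ = record
  { emb      = λ u → col u false
  ; view     = λ { (col u false) → just u ; (col _ true) → nothing ; (deeper _) → nothing }
  ; view-emb = λ _ → refl }

deeperₑ : Emb (Alph (suc k) m) (Alph k (suc m))
deeperₑ = record
  { emb      = deeper
  ; view     = λ { (col _ _) → nothing ; (deeper a) → just a }
  ; view-emb = λ _ → refl }

-- Decision procedures on columns and their Boolean combinations

columns : List (Vec Val k) → List (Alph k m)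
columns = map (emb columnₑ)

-- The word is returned unchanged, so that procedures can be sequenced and repeated inside a search.
-- `Pre` makes room for the freshness condition of nested searches.
record Decides (E : Emb (Alph k m) A) (Pre P : List (Vec Val k) → Set) : Set₁ where
  field
    machine : Mach A Bool
    time    : ℕ → ℕ
    poly    : Poly time
    correct : ∀ us → Pre us → ∃ λ b → Works E machine time (columns us) b (columns us) × Reflects (P us) b
open Decides

Always : B → Set
Always _ = ⊤

reflects-map : {P Q : Set} {b : Bool} → (P → Q) → (Q → P) → Reflects P b → Reflects Q b
reflects-map f g (ofʸ p)  = ofʸ (f p)
reflects-map f g (ofⁿ ¬p) = ofⁿ (¬p ∘ g)

decides-map : (E : Emb (Alph k m) A) {Pre P Q : List (Vec Val k) → Set} →
  (∀ us → P us → Q us) → (∀ us → Q us → P us) → Decides E Pre P → Decides E Pre Q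
decides-map E f g D = record
  { machine = machine D ; time = time D ; poly = poly D
  ; correct = λ us ok → let b , w , r = correct D us ok in b , w , reflects-map (f us) (g us) r }

decides-¬ : (E : Emb (Alph k m) A) {Pre P : List (Vec Val k) → Set} →
  Decides E Pre P → Decides E Pre (¬_ ∘ P)
decides-¬ E D = record
  { machine = bind Bool-finite (machine D) (ret ∘ not)
  ; time = λ n → time D n + 1 ; poly = poly-+ (poly D) (poly-const 1)
  ; correct = λ us ok → let b , w , r = correct D us ok in
      not b , works-bind E Bool-finite (machine D) (ret ∘ not) w (works-ret E (not b) _) , ¬-reflects r }

decides-× : (E : Emb (Alph k m) A) {Pre P Q : List (Vec Val k) → Set} →
  Decides E Pre P → Decides E Pre Q → Decides E Pre (λ us → P us × Q us)
decides-× {k = k} E {Pre} {P} {Q} D D' = record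
  { machine = bind Bool-finite (machine D) rest
  ; time = λ n → time D n + (time D' n + 1)
  ; poly = poly-+ (poly D) (poly-+ (poly D') (poly-const 1))
  ; correct = λ us ok → let b , w , r = correct D us ok ; b' , w' , r' = correct' b us ok r in
      b' , works-bind E Bool-finite (machine D) rest w w' , r' }
  where
  rest : Bool → Mach _ Bool
  rest true  = machine D'
  rest false = ret false

  correct' : ∀ b us → Pre us → Reflects (P us) b → ∃ λ b' →
    Works E (rest b) (λ n → time D' n + 1) (columns us) b' (columns us) × Reflects (P us × Q us) b'
  correct' true us ok r = let b , w , r' = correct D' us ok in
    b , works-weaken E (λ n _ → m≤m+n _ 1) w , (r ×-reflects r')
  correct' false us ok r =
    false , works-weaken E (λ n _ → m≤n+m 1 _) (works-ret E false _) , ofⁿ (invert r ∘ proj₁)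

decides-⊎ : (E : Emb (Alph k m) A) {Pre P Q : List (Vec Val k) → Set} →
  Decides E Pre P → Decides E Pre Q → Decides E Pre (λ us → P us ⊎ Q us)
decides-⊎ {k = k} E {Pre} {P} {Q} D D' = record
  { machine = bind Bool-finite (machine D) rest
  ; time = λ n → time D n + (time D' n + 1)
  ; poly = poly-+ (poly D) (poly-+ (poly D') (poly-const 1))
  ; correct = λ us ok → let b , w , r = correct D us ok ; b' , w' , r' = correct' b us ok r in
      b' , works-bind E Bool-finite (machine D) rest w w' , r' }
  where
  rest : Bool → Mach _ Bool
  rest true  = ret true
  rest false = machine D'

  correct' : ∀ b us → Pre us → Reflects (P us) b → ∃ λ b' →
    Works E (rest b) (λ n → time D' n + 1) (columns us) b' (columns us) × Reflects (P us ⊎ Q us) b'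
  correct' false us ok r = let b , w , r' = correct D' us ok in
    b , works-weaken E (λ n _ → m≤m+n _ 1) w , (r ⊎-reflects r')
  correct' true us ok r =
    true , works-weaken E (λ n _ → m≤n+m 1 _) (works-ret E true _) , ofʸ (inj₁ (invert r))

decides-All : (E : Emb (Alph k m) A) (p : Vec Val k → Bool) → Decides E Always (All (T ∘ p))
decides-All {k = k} {m = m} E p = record
  { machine = pass (E ∘ₑ columnₑ) Bool-finite check true ; time = passTime ; poly = poly-passTime
  ; correct = λ us _ → _ ,
      works-restrict E columnₑ (subst (Works (E ∘ₑ columnₑ) _ passTime us _) (unchanged true us)
        (works-pass (E ∘ₑ columnₑ) Bool-finite check true us)) ,
      reflects us }
  where
  check : Bool → Vec Val k → Bool × Vec Val k
  check b u = (b ∧ p u) , u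

  unchanged : ∀ b us → proj₂ (mapAccumL check b us) ≡ us
  unchanged b []       = refl
  unchanged b (u ∷ us) = cong (u ∷_) (unchanged _ us)

  stays-false : ∀ us → proj₁ (mapAccumL check false us) ≡ false
  stays-false []       = refl
  stays-false (u ∷ us) = stays-false us

  reflects : ∀ us → Reflects (All (T ∘ p) us) (proj₁ (mapAccumL check true us))
  reflects [] = ofʸ []
  reflects (u ∷ us) with p u in e
  ... | true  = reflects-map (λ ps → subst T (sym e) tt ∷ ps) All.tail (reflects us)
  ... | false rewrite stays-false us = ofⁿ λ { (pu ∷ _) → subst T e pu }

-- Comparing the numbers of columns with two properties

module _ (E : Emb (Alph k m) A) (p q : Vec Val k → Bool) where

  private
    F : Emb (Vec Val k × Bool) A
    F = E ∘ₑ markedₑ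

    unmarked : (Vec Val k → Bool) → Vec Val k × Bool → Bool
    unmarked r (u , b) = r u ∧ not b

    mark unmark : Vec Val k × Bool → Vec Val k × Bool
    mark   (u , _) = u , true
    unmark (u , _) = u , false

    -- Columns with both properties add the same amount to both counts. Leaving them out makes the
    -- two classes disjoint, so that marking a column lowers only one of the tallies.
    p∖q q∖p : Vec Val k → Bool
    p∖q u = p u ∧ not (q u)
    q∖p u = q u ∧ not (p u)

    only-p only-q : Vec Val k × Bool → Bool
    only-p = unmarked p∖q
    only-q = unmarked q∖p

    markP : Bool → Mach A (Maybe Bool)
    markP false = ret (just true)
    markP true  = bind Bool-finite (replacePass only-p mark F) (λ found → ret (if found then nothing else just false))

    -- A round pairs a column of the `q` side with one of the `p` side. The answer is `true` if the
    -- `q` side is exhausted, and `false` if a `q` column finds no partner.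
    cancel : Mach A (Maybe Bool)
    cancel = bind Bool-finite (replacePass only-q mark F) markP

    cancelTime : ℕ → ℕ
    cancelTime n = passTime n + (passTime n + 1)

    marked-false : ∀ r u → unmarked r (mark u) ≡ false
    marked-false r (u , _) with r u
    ... | true  = refl
    ... | false = refl

    only-p⇒¬only-q : ∀ x → only-p x ≡ true → only-q x ≡ false
    only-p⇒¬only-q (u , b) e with p u | q u
    ... | true  | false = refl
    ... | true  | true  = refl
    ... | false | true with () ← e
    ... | false | false = refl

    only-q⇒¬only-p : ∀ x → only-q x ≡ true → only-p x ≡ false
    only-q⇒¬only-p (u , b) e with p u | q u
    ... | false | true  = refl
    ... | true  | true  = refl
    ... | true  | false with () ← e
    ... | false | false = refl

    unmark-mark : ∀ xs l ys → map unmark (xs ++ mark l ∷ ys) ≡ map unmark (xs ++ l ∷ ys)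
    unmark-mark xs l ys rewrite map-++ unmark xs (mark l ∷ ys) | map-++ unmark xs (l ∷ ys) = refl

    -- Induction on the number of uncancelled columns on the `q` side; `suc n` counts the exiting
    -- round too. Only marks change, so the image under `unmark` is invariant.
    cancel-all : ∀ n ws → tally only-q ws ≡ n → ∃ λ b → ∃ λ ws' →
      Works F (loop cancel) (λ N → suc n * cancelTime N) ws b ws' ×
      map unmark ws' ≡ map unmark ws × Reflects (n ≤ tally only-p ws) b
    cancel-all n ws e with works-replacePass only-q mark F ws
    ... | _ , w , none z = true , ws ,
          works-loop-done F cancel (works-weaken F
            (λ N _ → ≤-trans (+-monoʳ-≤ (passTime N) (m≤n+m 1 (passTime N))) (m≤m+n (cancelTime N) _))
            (works-bind F Bool-finite _ markP w (works-ret F (just true) ws))) ,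
          refl , ofʸ (subst (_≤ _) (trans (sym z) e) z≤n)
    cancel-all zero ws e | _ , w , some xs l ys ql refl
      with () ← trans (sym e) (tally-replace only-q xs {l' = mark l} ys ql (marked-false q∖p l))
    cancel-all (suc n) ws e | _ , w , some xs l ys ql refl
      with works-replacePass only-p mark F (xs ++ mark l ∷ ys)
    ... | _ , w' , none z = false , _ ,
          works-loop-done F cancel (works-weaken F
            (λ N _ → m≤m+n (cancelTime N) _)
            (works-bind F Bool-finite _ markP w (works-bind F Bool-finite _ _ w' (works-ret F (just false) _)))) ,
          unmark-mark xs l ys ,
          ofⁿ λ le → 1+n≰n (≤-trans (s≤s z≤n) (≤-trans le (≤-reflexive (trans only-p-kept z))))
      where
      only-p-kept : tally only-p (xs ++ l ∷ ys) ≡ tally only-p (xs ++ mark l ∷ ys)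
      only-p-kept = tally-unchanged only-p xs ys (only-q⇒¬only-p l ql) (marked-false p∖q l)
    -- Both tallies drop by exactly one in this round, so their comparison keeps its truth value.
    ... | _ , w' , some xs' l' ys' pl' ws≡ =
      let b , ws' , w'' , un , r = cancel-all n (xs' ++ mark l' ∷ ys') (suc-injective (trans (sym only-q-drops) e)) in
      b , ws' ,
      works-loop-again F cancel
        (works-bind F Bool-finite _ markP w (works-bind F Bool-finite _ _ w' (works-ret F nothing _))) w'' ,
      trans un (trans (unmark-mark xs' l' ys') (trans (cong (map unmark) (sym ws≡)) (unmark-mark xs l ys))) ,
      reflects-map (λ le → subst (suc n ≤_) (sym only-p-drops) (s≤s le))
                   (λ le → s≤s⁻¹ (subst (suc n ≤_) only-p-drops le)) r
      where
      only-p-drops : tally only-p (xs ++ l ∷ ys) ≡ suc (tally only-p (xs' ++ mark l' ∷ ys'))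
      only-p-drops = trans (tally-unchanged only-p xs ys (only-q⇒¬only-p l ql) (marked-false p∖q l))
        (trans (cong (tally only-p) ws≡) (tally-replace only-p xs' ys' pl' (marked-false p∖q l')))

      only-q-drops : tally only-q (xs ++ l ∷ ys) ≡ suc (tally only-q (xs' ++ mark l' ∷ ys'))
      only-q-drops = trans (tally-replace only-q xs ys ql (marked-false q∖p l))
        (cong suc (trans (cong (tally only-q) ws≡)
          (tally-unchanged only-q xs' ys' (only-p⇒¬only-q l' pl') (marked-false q∖p l'))))

    unmarked-tally : ∀ r us → tally (unmarked r) (map (_, false) us) ≡ tally r us
    unmarked-tally r us = trans (tally-map (unmarked r) (_, false) us) (tally-cong (λ u → ∧-identityʳ (r u)) us)

    common : List (Vec Val k) → ℕ
    common = tally (λ u → p u ∧ q u)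

    p-split : ∀ us → tally p us ≡ common us + tally only-p (map (_, false) us)
    p-split us = trans (tally-split p q us) (cong (common us +_) (sym (unmarked-tally _ us)))

    q-split : ∀ us → tally q us ≡ common us + tally only-q (map (_, false) us)
    q-split us = trans (tally-split q p us)
      (cong₂ _+_ (tally-cong (λ u → ∧-comm (q u) (p u)) us) (sym (unmarked-tally _ us)))

  decides-tally-≤ : Decides E Always (λ us → tally q us ≤ tally p us)
  decides-tally-≤ = record
    { machine = bind Bool-finite (loop cancel) finish
    ; time = λ n → suc n * cancelTime n + (passTime n + 1)
    ; poly = poly-+ (poly-* (poly-+ (poly-const 1) poly-id) (poly-+ poly-passTime (poly-+ poly-passTime (poly-const 1))))
                    (poly-+ poly-passTime (poly-const 1))
    ; correct = λ us _ → let b , ws' , w , un , r = cancel-all _ (map (_, false) us) refl in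
        b ,
        subst₂ (λ v v' → Works E _ _ v b v') (sym (map-∘ us)) (sym (map-∘ us))
          (works-restrict E markedₑ
            (works-bind F Bool-finite (loop cancel) finish
              (works-weaken F (λ n le → *-monoˡ-≤ (cancelTime n)
                  (s≤s (≤-trans (tally-≤-length only-q (map (_, false) us)) le))) w)
              (works-bind F ⊤-finite _ (λ _ → ret b)
                (subst (Works F _ passTime ws' tt) (trans un (sym (map-∘ us)))
                  (works-mapPass F unmark ws'))
                (works-ret F b _)))) ,
        reflects-map
          (λ le → subst₂ _≤_ (sym (q-split us)) (sym (p-split us)) (+-monoʳ-≤ (common us) le))
          (λ le → +-cancelˡ-≤ (common us) _ _ (subst₂ _≤_ (q-split us) (p-split us) le)) r }
    where
    finish : Bool → Mach A Bool
    finish b = bind ⊤-finite (mapPass F unmark) (λ _ → ret b)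

-- Searching the extensions of a list of columns

_≟V_ : (v w : Val) → Dec (v ≡ w)
v0  ≟V v0  = yes refl
v0  ≟V v1  = no λ ()
v0  ≟V bot = no λ ()
v1  ≟V v0  = no λ ()
v1  ≟V v1  = yes refl
v1  ≟V bot = no λ ()
bot ≟V v0  = no λ ()
bot ≟V v1  = no λ ()
bot ≟V bot = yes refl

_≟C_ : (u v : Vec Val k) → Dec (u ≡ v)
_≟C_ = ≡-dec _≟V_

base : Vec Val (suc k) → Vec Val (suc k)
base (_ ∷ u) = bot ∷ u

tail-base : (b : Vec Val (suc k)) → tail (base b) ≡ tail b
tail-base (_ ∷ _) = refl

-- The permutations on both sides hide the position of the rewritten column.
Move₁ : Vec Val (suc k) → List (Vec Val (suc k)) → List (Vec Val (suc k)) → Set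
Move₁ b ws ws' = ∃ λ vs → ws ↭ base b ∷ vs × ws' ↭ b ∷ vs

Reach : List (Vec Val (suc k)) → (List (Vec Val (suc k)) → Set) → List (Vec Val (suc k)) → Set
Reach []       P ws = P ws
Reach (b ∷ bs) P ws = ∃ λ ws' → Star (Move₁ b) ws ws' × Reach bs P ws'

-- Undoing a search turns every `b` back into `base b`, which recovers the original word only if it
-- contained no `b` to begin with.
Fresh : List (Vec Val k) → List (Vec Val k) → Set
Fresh bs ws = All (_∉ ws) bs

Symmetric : (List B → Set) → Set
Symmetric P = ∀ {ws ws'} → ws ↭ ws' → P ws → P ws'

reach-symmetric : ∀ bs {P : List (Vec Val (suc k)) → Set} → Symmetric P → Symmetric (Reach bs P)
reach-symmetric []       sym-P e r = sym-P e r
reach-symmetric (b ∷ bs) sym-P e (_ , ε , r) = _ , ε , reach-symmetric bs sym-P e r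
reach-symmetric (b ∷ bs) sym-P e (_ , (vs , p , q) ◅ s , r) = _ , (vs , ↭-trans (↭-sym e) p , q) ◅ s , r

module _ (E : Emb (Alph (suc k) m) A) {bs : List (Vec Val (suc k))} {P : List (Vec Val (suc k)) → Set}
         (sym-P : Symmetric P) (D : Decides E (Fresh bs) P)
         (b : Vec Val (suc k)) (base≢b : base b ≢ b) (b∉bs : All (b ≢_) bs) where

  private
    F : Emb (Vec Val (suc k)) A
    F = E ∘ₑ columnₑ

    isBase : Vec Val (suc k) → Bool
    isBase u = does (u ≟C base b)

    restore : Vec Val (suc k) → Vec Val (suc k)
    restore u = if does (u ≟C b) then base b else u

    retry : Bool → Mach A (Maybe Bool)
    retry true  = ret (just true)
    retry false = bind Bool-finite (replacePass isBase (const b) F) (λ found → ret (if found then nothing else just false))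

    try : Mach A (Maybe Bool)
    try = bind Bool-finite (machine D) retry

    tryTime : ℕ → ℕ
    tryTime n = time D n + (passTime n + 1)

    isBase⇒≡ : ∀ u → isBase u ≡ true → u ≡ base b
    isBase⇒≡ u e with u ≟C base b
    ... | yes p = p
    isBase⇒≡ u () | no _

    isBase-base : isBase (base b) ≡ true
    isBase-base = dec-true (base b ≟C base b) refl

    isBase-b : isBase b ≡ false
    isBase-b = dec-false (b ≟C base b) (base≢b ∘ sym)

    restore-b : restore b ≡ base b
    restore-b rewrite dec-true (b ≟C b) refl = refl

    restore-other : ∀ {u} → u ≢ b → restore u ≡ u
    restore-other {u} u≢b rewrite dec-false (u ≟C b) u≢b = refl

    -- The invariant of the search loop: wherever the loop stops, one `restore` pass leads back to
    -- the initial word.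
    restore-replaced : ∀ xs ys → map restore (xs ++ b ∷ ys) ≡ map restore (xs ++ base b ∷ ys)
    restore-replaced xs ys
      rewrite map-++ restore xs (b ∷ ys) | map-++ restore xs (base b ∷ ys)
            | restore-b | restore-other base≢b = refl

    restore-fresh : ∀ us → b ∉ us → map restore us ≡ us
    restore-fresh []       _ = refl
    restore-fresh (u ∷ us) n = cong₂ _∷_ (restore-other (λ e → n (here (sym e)))) (restore-fresh us (n ∘ there))

    move₁ : ∀ xs ys → Move₁ b (xs ++ base b ∷ ys) (xs ++ b ∷ ys)
    move₁ xs ys = xs ++ ys , shift (base b) xs ys , shift b xs ys

    -- The only type that a move can introduce is `b`, which differs from all of `bs`; hence the
    -- inner loops keep their precondition.
    fresh-move₁ : ∀ {us us'} → Move₁ b us us' → Fresh bs us → Fresh bs us'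
    fresh-move₁ (vs , p , q) fresh = All.zipWith
      (λ (b≢c , c∉us) c∈us' → case∈ b≢c c∉us (∈-resp-↭ q c∈us')) (b∉bs , fresh)
      where
      case∈ : ∀ {c} → b ≢ c → c ∉ _ → ¬ (c ∈ b ∷ vs)
      case∈ b≢c c∉us (here e)  = b≢c (sym e)
      case∈ b≢c c∉us (there i) = c∉us (∈-resp-↭ (↭-sym p) (there i))

    Found : List (Vec Val (suc k)) → Set
    Found us = ∃ λ us' → Star (Move₁ b) us us' × P us'

    found-here : ∀ us → base b ∉ us → ¬ P us → ¬ Found us
    found-here us no-base ¬P (_ , ε , p) = ¬P p
    found-here us no-base ¬P (_ , (vs , e , _) ◅ _ , _) = no-base (∈-resp-↭ (↭-sym e) (here refl))

    -- Moves are deterministic up to permutation, so it does not matter which column is moved.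
    found-next : ∀ {us us'} → Move₁ b us us' → ¬ P us → Found us → Found us'
    found-next _ ¬P (_ , ε , p) with () ← ¬P p
    found-next (vs , e , q) ¬P (_ , (vs' , e' , q') ◅ s , p) =
      reach-symmetric (b ∷ []) sym-P
        (↭-trans q' (↭-trans (prep b (drop-∷ (↭-trans (↭-sym e') e))) (↭-sym q))) (_ , s , p)

    -- `D` runs before each rewriting, which covers the choice of no move at all. The number of
    -- remaining base columns is the measure, and once it is zero no further choice exists.
    search : ∀ n us → tally isBase us ≡ n → Fresh bs us → ∃ λ r → ∃ λ us' →
      Works E (loop try) (λ N → suc n * tryTime N) (columns us) r (columns us') ×
      map restore us' ≡ map restore us × Reflects (Found us) r
    search n us e fresh with correct D us fresh
    ... | true , w , ofʸ p = true , us ,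
          works-loop-done E try (works-weaken E
            (λ N _ → ≤-trans (+-monoʳ-≤ (time D N) (m≤n+m 1 (passTime N))) (m≤m+n (tryTime N) _))
            (works-bind E Bool-finite _ retry w (works-ret E (just true) _))) ,
          refl , ofʸ (_ , ε , p)
    ... | false , w , ofⁿ ¬p with works-replacePass isBase (const b) F us
    ...   | _ , w' , none z = false , us ,
            works-loop-done E try (works-weaken E (λ N _ → m≤m+n (tryTime N) _)
              (works-bind E Bool-finite _ retry w
                (works-bind E Bool-finite _ _ (works-restrict E columnₑ w') (works-ret E (just false) _)))) ,
            refl , ofⁿ (found-here us (tally≡0⇒∉ isBase z isBase-base) ¬p)
    ...   | _ , w' , some xs l ys bl refl with refl ← isBase⇒≡ l bl with n
    ...     | zero with () ← trans (sym e) (tally-replace isBase xs {l' = b} ys isBase-base isBase-b)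
    ...     | suc n' =
      let r , us' , w'' , re , refl-r = search n' (xs ++ b ∷ ys)
            (suc-injective (trans (sym (tally-replace isBase xs {l' = b} ys isBase-base isBase-b)) e))
            (fresh-move₁ (move₁ xs ys) fresh) in
      r , us' ,
      works-loop-again E try
        (works-bind E Bool-finite _ retry w
          (works-bind E Bool-finite _ _ (works-restrict E columnₑ w') (works-ret E nothing _))) w'' ,
      trans re (restore-replaced xs ys) ,
      reflects-map (λ (us'' , s , p) → us'' , move₁ xs ys ◅ s , p) (found-next (move₁ xs ys) ¬p) refl-r

  decides-move : Decides E (Fresh (b ∷ bs)) Found
  decides-move = record
    { machine = bind Bool-finite (loop try) finish
    ; time = λ n → suc n * tryTime n + (passTime n + 1)
    ; poly = poly-+ (poly-* (poly-+ (poly-const 1) poly-id) (poly-+ (poly D) (poly-+ poly-passTime (poly-const 1))))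
                    (poly-+ poly-passTime (poly-const 1))
    ; correct = λ { us (b∉us ∷ fresh) →
        let r , us' , w , re , refl-r = search _ us refl fresh in
        r ,
        works-bind E Bool-finite (loop try) finish
          (works-weaken E (λ n le → *-monoˡ-≤ (tryTime n)
              (s≤s (≤-trans (tally-≤-length isBase us) (subst (_≤ n) (length-map _ us) le)))) w)
          (works-bind E ⊤-finite _ (λ _ → ret r)
            (subst (λ v → Works E _ passTime (columns us') tt (columns v)) (trans re (restore-fresh us b∉us))
              (works-restrict E columnₑ (works-mapPass F restore us')))
            (works-ret E r _)) ,
        refl-r } }
    where
    finish : Bool → Mach A Bool
    finish r = bind ⊤-finite (mapPass F restore) (λ _ → ret r)

-- Each type in `bs` wraps one more loop around the procedure and multiplies its time by at most a
-- polynomial factor, up to lower terms; `bs` does not depend on the input, so the bound stays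
-- polynomial.
decides-reach : (E : Emb (Alph (suc k) m) A) {P : List (Vec Val (suc k)) → Set} → Symmetric P →
  Decides E Always P → ∀ {bs} → Unique bs → All (λ b → base b ≢ b) bs → Decides E (Fresh bs) (Reach bs P)
decides-reach E sym-P D [] [] = record
  { machine = machine D ; time = time D ; poly = poly D ; correct = λ us _ → correct D us tt }
decides-reach E sym-P D {b ∷ bs} (b∉bs ∷ uniq) (base≢b ∷ rest) =
  decides-move E (reach-symmetric bs sym-P) (decides-reach E sym-P D uniq rest) b base≢b b∉bs

-- `b` and `base b` have the same tail, so the multiset of tails is invariant under moves.
reach-sound : ∀ bs {P : List (Vec Val (suc k)) → Set} {ws} → Reach bs P ws →
  ∃ λ ws' → map tail ws' ↭ map tail ws × P ws'
reach-sound []       r = _ , ↭-refl , r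
reach-sound {k} (b ∷ bs) (_ , s , r) = let ws' , e , p = reach-sound bs r in ws' , ↭-trans e (↭-sym (tails s)) , p
  where
  tails : ∀ {ws ws'} → Star (Move₁ b) ws ws' → map tail ws ↭ map tail ws'
  tails ε = ↭-refl
  tails ((vs , e , e') ◅ s) = ↭-trans (↭-map⁺ tail e)
    (↭-trans (subst (λ t → tail (base b) ∷ map tail vs ↭ t ∷ map tail vs) (tail-base b) ↭-refl)
      (↭-trans (↭-sym (↭-map⁺ tail e')) (tails s)))

-- The state of one position during the nested loops: either it has its final type `v`, or it is
-- still at the base of `v` and the loop for `v` lies ahead.
Target : List (Vec Val (suc k)) → Vec Val (suc k) → Vec Val (suc k) → Set
Target bs u v = u ≡ v ⊎ (v ∈ bs × u ≡ base v)

-- Each level rewrites exactly the positions whose membership witness points to its own `b`; a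
-- witness further down the list is passed on to the inner levels.
reach-complete : ∀ bs {P : List (Vec Val (suc k)) → Set} {ws vs} → Pointwise (Target bs) ws vs → P vs → Reach bs P ws
reach-complete [] {P} pw p = subst P (sym (all-equal pw)) p
  where
  all-equal : ∀ {ws vs} → Pointwise (Target []) ws vs → ws ≡ vs
  all-equal [] = refl
  all-equal (inj₁ e ∷ pw) = cong₂ _∷_ e (all-equal pw)
reach-complete (b ∷ bs) pw p = let us , s , pw' = moves pw in us , s , reach-complete bs pw' p
  where
  under : ∀ x {ws ws'} → Move₁ b ws ws' → Move₁ b (x ∷ ws) (x ∷ ws')
  under x (vs , e , e') = x ∷ vs , ↭-trans (prep x e) (swap x _ ↭-refl) , ↭-trans (prep x e') (swap x _ ↭-refl)

  moves : ∀ {ws vs} → Pointwise (Target (b ∷ bs)) ws vs → ∃ λ us → Star (Move₁ b) ws us × Pointwise (Target bs) us vs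
  moves [] = [] , ε , []
  moves (_∷_ {x = x} t pw) with moves pw | t
  ... | us , s , pw' | inj₁ e = x ∷ us , gmap (x ∷_) (under x) s , inj₁ e ∷ pw'
  ... | us , s , pw' | inj₂ (there i , e) = x ∷ us , gmap (x ∷_) (under x) s , inj₂ (i , e) ∷ pw'
  ... | us , s , pw' | inj₂ (here refl , refl) =
    b ∷ us , (_ , ↭-refl , ↭-refl) ◅ gmap (b ∷_) (under b) s , inj₁ refl ∷ pw'

-- Head ⊥ is the starting point and gets no loop. Nested loops need distinct types, which `Finite`
-- does not promise, hence `deduplicate`.
definite : ∀ k → List (Vec Val (suc k))
definite k = let us = proj₁ (Vec-finite Val-finite k) in deduplicate _≟C_ (map (v0 ∷_) us ++ map (v1 ∷_) us)

definite-unique : ∀ k → Unique (definite k)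
definite-unique k = deduplicate-! _≟C_ _

definite-base : ∀ k → All (λ b → base b ≢ b) (definite k)
definite-base k = All.tabulate λ {b} b∈ → differs (∈-++⁻ (map (v0 ∷_) us) (∈-deduplicate⁻ _≟C_ _ b∈))
  where
  us = proj₁ (Vec-finite Val-finite k)
  differs : ∀ {b} → b ∈ map (v0 ∷_) us ⊎ b ∈ map (v1 ∷_) us → base b ≢ b
  differs (inj₁ i) with _ , _ , refl ← ∈-map⁻ (v0 ∷_) i = λ ()
  differs (inj₂ i) with _ , _ , refl ← ∈-map⁻ (v1 ∷_) i = λ ()

definite-target : (v : Vec Val (suc k)) → Target (definite k) (bot ∷ tail v) v
definite-target (bot ∷ u) = inj₁ refl
definite-target {k} (v0 ∷ u) = inj₂ (∈-deduplicate⁺ _≟C_ (∈-++⁺ˡ (∈-map⁺ (v0 ∷_) (proj₂ (Vec-finite Val-finite k) u))) , refl)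
definite-target {k} (v1 ∷ u) = inj₂ (∈-deduplicate⁺ _≟C_ (∈-++⁺ʳ _ (∈-map⁺ (v1 ∷_) (proj₂ (Vec-finite Val-finite k) u))) , refl)

Extends : (List (Vec Val (suc k)) → Set) → List (Vec Val k) → Set
Extends P us = ∃ λ ws → map tail ws ≡ us × P ws

-- The search controls the tails only up to permutation. `↭-map-inv` lifts that permutation from the
-- tails to the whole columns, and the symmetry of `P` carries the property along.
extends⇔reach : {P : List (Vec Val (suc k)) → Set} → Symmetric P → ∀ us →
  (Reach (definite k) P (map (bot ∷_) us) → Extends P us) × (Extends P us → Reach (definite k) P (map (bot ∷_) us))
extends⇔reach {k} {P} sym-P us = sound , complete
  where
  tails : map tail (map (bot ∷_) us) ≡ us
  tails = trans (sym (map-∘ us)) (map-id us)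

  sound : Reach (definite k) P (map (bot ∷_) us) → Extends P us
  sound r with ws , e , p ← reach-sound (definite k) r
          with ws' , e' , e'' ← ↭-map-inv tail e = ws' , trans (sym e') tails , sym-P e'' p

  targets : ∀ ws → Pointwise (Target (definite k)) (map (bot ∷_) (map tail ws)) ws
  targets []       = []
  targets (w ∷ ws) = definite-target w ∷ targets ws

  complete : Extends P us → Reach (definite k) P (map (bot ∷_) us)
  complete (ws , refl , p) = reach-complete (definite k) (targets ws) p

decides-extends : (E : Emb (Alph k (suc m)) A) {P : List (Vec Val (suc k)) → Set} → Symmetric P →
  Decides (E ∘ₑ deeperₑ) Always P → Decides E Always (Extends P)
decides-extends {k} {m} {A} E {P} sym-P D = record
  { machine = bind ⊤-finite (mapPass E up) inner
  ; time = λ n → passTime n + (time DR n + (passTime n + 1))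
  ; poly = poly-+ poly-passTime (poly-+ (poly DR) (poly-+ poly-passTime (poly-const 1)))
  ; correct = λ us _ → let r , w , refl-r = correct DR (map (bot ∷_) us) (fresh us) in
      r ,
      works-bind E ⊤-finite (mapPass E up) inner
        (subst (Works E (mapPass E up) passTime (columns us) tt) (up-columns us) (works-mapPass E up (columns us)))
        (works-bind E Bool-finite (machine DR) outer (works-restrict E deeperₑ w)
          (works-bind E ⊤-finite (mapPass E down) (λ _ → ret r)
            (subst (Works E (mapPass E down) passTime _ tt) (down-columns us) (works-mapPass E down _))
            (works-ret E r _))) ,
      reflects-map (proj₁ (extends⇔reach sym-P us)) (proj₂ (extends⇔reach sym-P us)) refl-r }
  where
  DR : Decides (E ∘ₑ deeperₑ) (Fresh (definite k)) (Reach (definite k) P)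
  DR = decides-reach (E ∘ₑ deeperₑ) sym-P D (definite-unique k) (definite-base k)

  up down : Alph k (suc m) → Alph k (suc m)
  up (col u _)  = deeper (col (bot ∷ u) false)
  up (deeper a) = deeper a
  -- The search has restored its starting word, so the dropped head is the ⊥ that `up` had put
  -- there.
  down (deeper (col (_ ∷ u) _)) = col u false
  down a = a

  outer : Bool → Mach A Bool
  outer r = bind ⊤-finite (mapPass E down) (λ _ → ret r)

  inner : ⊤ → Mach A Bool
  inner _ = bind Bool-finite (machine DR) outer

  up-columns : ∀ us → map up (columns us) ≡ map deeper (columns (map (bot ∷_) us))
  up-columns []       = refl
  up-columns (u ∷ us) = cong (_ ∷_) (up-columns us)

  down-columns : ∀ us → map down (map deeper (columns (map (bot ∷_) us))) ≡ columns us
  down-columns []       = refl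
  down-columns (u ∷ us) = cong (_ ∷_) (down-columns us)

  fresh : ∀ us → Fresh (definite k) (map (bot ∷_) us)
  fresh us = All.map notin (definite-base k)
    where
    notin : ∀ {b} → base b ≢ b → b ∉ map (bot ∷_) us
    notin base≢b i with _ , _ , refl ← ∈-map⁻ (bot ∷_) i = base≢b refl

-- First-order formulas over columns

isBot : Fin k → Vec Val k → Bool
isBot x u = does (lookup u x ≟V bot)

SatC : Formula k → List (Vec Val k) → Set
SatC (sub x y)  us = All (λ u → lookup u x ≢ bot → lookup u x ≡ lookup u y) us
SatC (pre x y)  us = tally (isBot y) us ≤ tally (isBot x) us
SatC (eq x y)   us = All (λ u → lookup u x ≡ lookup u y) us
SatC (neg φ)    us = ¬ SatC φ us
SatC (conj φ ψ) us = SatC φ us × SatC ψ us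
SatC (disj φ ψ) us = SatC φ us ⊎ SatC ψ us
SatC (ex φ)     us = Extends (SatC φ) us
SatC (all φ)    us = ∀ ws → map tail ws ≡ us → SatC φ ws

-- At a quantifier, a permutation of the columns lifts to any extension of them by `↭-map-inv`.
satC-symmetric : (φ : Formula k) → Symmetric (SatC φ)
satC-symmetric (sub x y)  e s = All-resp-↭ e s
satC-symmetric (pre x y)  e s = subst₂ _≤_ (tally-resp-↭ (isBot y) e) (tally-resp-↭ (isBot x) e) s
satC-symmetric (eq x y)   e s = All-resp-↭ e s
satC-symmetric (neg φ)    e s = s ∘ satC-symmetric φ (↭-sym e)
satC-symmetric (conj φ ψ) e (s , t)  = satC-symmetric φ e s , satC-symmetric ψ e t
satC-symmetric (disj φ ψ) e (inj₁ s) = inj₁ (satC-symmetric φ e s)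
satC-symmetric (disj φ ψ) e (inj₂ s) = inj₂ (satC-symmetric ψ e s)
satC-symmetric (ex φ) e (ws , refl , s) with ws' , e' , e'' ← ↭-map-inv tail e = ws' , sym e' , satC-symmetric φ e'' s
satC-symmetric (all φ) e s ws refl with ws' , e' , e'' ← ↭-map-inv tail (↭-sym e) =
  satC-symmetric φ (↭-sym e'') (s ws' (sym e'))

depth : Formula k → ℕ
depth (sub x y)  = 0
depth (pre x y)  = 0
depth (eq x y)   = 0
depth (neg φ)    = depth φ
depth (conj φ ψ) = depth φ ⊔ depth ψ
depth (disj φ ψ) = depth φ ⊔ depth ψ
depth (ex φ)     = suc (depth φ)
depth (all φ)    = suc (depth φ)

decides-AllDec : (E : Emb (Alph k m) A) {P : Vec Val k → Set} → (∀ u → Dec (P u)) → Decides E Always (All P)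
decides-AllDec E P? = decides-map E (λ _ → All.map toWitness) (λ _ → All.map fromWitness)
  (decides-All E (λ u → isYes (P? u)))

-- `m` is the number of further arities that the alphabet still offers; each quantifier uses up one
-- of them by passing under `deeper`.
decides-satC : (E : Emb (Alph k m) A) (φ : Formula k) → depth φ ≤ m → Decides E Always (SatC φ)
decides-satC E (sub x y) _ = decides-AllDec E (λ u → ¬? (lookup u x ≟V bot) →-dec (lookup u x ≟V lookup u y))
decides-satC E (pre x y) _ = decides-tally-≤ E (isBot x) (isBot y)
decides-satC E (eq x y)  _ = decides-AllDec E (λ u → lookup u x ≟V lookup u y)
decides-satC E (neg φ)   d = decides-¬ E (decides-satC E φ d)
decides-satC E (conj φ ψ) d = decides-× E (decides-satC E φ (m⊔n≤o⇒m≤o _ _ d)) (decides-satC E ψ (m⊔n≤o⇒n≤o (depth φ) _ d))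
decides-satC E (disj φ ψ) d = decides-⊎ E (decides-satC E φ (m⊔n≤o⇒m≤o _ _ d)) (decides-satC E ψ (m⊔n≤o⇒n≤o (depth φ) _ d))
decides-satC E (ex φ) (s≤s d) = decides-extends E (satC-symmetric φ) (decides-satC (E ∘ₑ deeperₑ) φ d)
decides-satC E (all φ) (s≤s d) =
  decides-map E (λ us ¬ext ws e → stable ws (λ ¬s → ¬ext (ws , e , ¬s)))
                (λ us s (ws , e , ¬s) → ¬s (s ws e))
    (decides-¬ E (decides-extends E (satC-symmetric (neg φ)) (decides-¬ (E ∘ₑ deeperₑ) D)))
  where
  D = decides-satC (E ∘ₑ deeperₑ) φ d

  -- From ¬∃¬ one constructively gets only a double negation, which the procedure for the body
  -- removes by deciding it.
  stable : ∀ ws → ¬ ¬ SatC φ ws → SatC φ ws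
  stable ws ¬¬s with correct D ws tt
  ... | true  , _ , ofʸ s  = s
  ... | false , _ , ofⁿ ¬s with () ← ¬¬s ¬s

-- Transposing a tuple of instances into columns

cols : ∀ {n k} → Vec (PInst n) k → Vec (Vec Val k) n
-- Without any row there are still `n` empty columns: a quantifier must be able to add a row of the
-- right dimension.
cols []      = Vec.replicate _ []
cols (e ∷ ρ) = zipWith _∷_ e (cols ρ)

map-tail-zipWith : ∀ {n k} (e : PInst n) (us : Vec (Vec Val k) n) → map tail (toList (zipWith _∷_ e us)) ≡ toList us
map-tail-zipWith []      []       = refl
map-tail-zipWith (v ∷ e) (u ∷ us) = cong (u ∷_) (map-tail-zipWith e us)

map-head-zipWith : ∀ {n k} (e : PInst n) (us : Vec (Vec Val k) n) →
  map (encVal ∘ head) (toList (zipWith _∷_ e us)) ≡ encPInst e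
map-head-zipWith []      []       = refl
map-head-zipWith (v ∷ e) (u ∷ us) = cong (_ ∷_) (map-head-zipWith e us)

-- The heads of the extended columns form the row, so ranging over extensions in `SatC` is the same
-- as ranging over instances in `Sat`.
unzip-tail : ∀ {n k} (us : Vec (Vec Val k) n) ws → map tail ws ≡ toList us →
  ∃ λ (e : PInst n) → ws ≡ toList (zipWith _∷_ e us)
unzip-tail []       []             p = [] , refl
unzip-tail (u ∷ us) ((v ∷ u') ∷ ws) p with refl , p' ← ∷-injective p with e , refl ← unzip-tail us ws p' = v ∷ e , refl

row-cols : ∀ {n k} (ρ : Vec (PInst n) k) x → lookup ρ x ≡ Vec.map (λ u → lookup u x) (cols ρ)
row-cols (e ∷ ρ) zero = zip-head e (cols ρ)
  where
  zip-head : ∀ {n k} (e : PInst n) (us : Vec (Vec Val k) n) → e ≡ Vec.map (λ u → lookup u zero) (zipWith _∷_ e us)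
  zip-head []      []       = refl
  zip-head (v ∷ e) (u ∷ us) = cong (v ∷_) (zip-head e us)
row-cols (e ∷ ρ) (suc x) = trans (row-cols ρ x) (zip-tail e (cols ρ))
  where
  zip-tail : ∀ {n k} {x : Fin k} (e : PInst n) (us : Vec (Vec Val k) n) →
    Vec.map (λ u → lookup u x) us ≡ Vec.map (λ u → lookup u (suc x)) (zipWith _∷_ e us)
  zip-tail []      []       = refl
  zip-tail (v ∷ e) (u ∷ us) = cong (_ ∷_) (zip-tail e us)

countBot-row : ∀ {n k} (us : Vec (Vec Val k) n) x → countBot (Vec.map (λ u → lookup u x) us) ≡ tally (isBot x) (toList us)
countBot-row []       x = refl
countBot-row (u ∷ us) x with lookup u x
... | v0  = countBot-row us x
... | v1  = countBot-row us x
... | bot = cong suc (countBot-row us x)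

all-toList⁺ : ∀ {n} {P : A → Set} (us : Vec A n) → (∀ i → P (lookup us i)) → All P (toList us)
all-toList⁺ []       p = []
all-toList⁺ (u ∷ us) p = p zero ∷ all-toList⁺ us (p ∘ suc)

all-toList⁻ : ∀ {n} {P : A → Set} (us : Vec A n) → All P (toList us) → ∀ i → P (lookup us i)
all-toList⁻ (u ∷ us) (p ∷ ps) zero    = p
all-toList⁻ (u ∷ us) (p ∷ ps) (suc i) = all-toList⁻ us ps i

map-≡⁺ : ∀ {n} {f g : A → B} (us : Vec A n) → All (λ u → f u ≡ g u) (toList us) → Vec.map f us ≡ Vec.map g us
map-≡⁺ []       []       = refl
map-≡⁺ (u ∷ us) (p ∷ ps) = cong₂ _∷_ p (map-≡⁺ us ps)

map-≡⁻ : ∀ {n} {f g : A → B} (us : Vec A n) → Vec.map f us ≡ Vec.map g us → All (λ u → f u ≡ g u) (toList us)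
map-≡⁻ []       p = []
map-≡⁻ (u ∷ us) p = ∷-injectiveˡ p ∷ map-≡⁻ us (∷-injectiveʳ p)

SubAt : Fin k → Fin k → Vec Val k → Set
SubAt x y u = lookup u x ≢ bot → lookup u x ≡ lookup u y

sat⇒satC : ∀ {n k} (φ : Formula k) (ρ : Vec (PInst n) k) → Sat φ ρ → SatC φ (toList (cols ρ))
satC⇒sat : ∀ {n k} (φ : Formula k) (ρ : Vec (PInst n) k) → SatC φ (toList (cols ρ)) → Sat φ ρ

sat⇒satC (sub x y) ρ s rewrite row-cols ρ x | row-cols ρ y = all-toList⁺ (cols ρ) λ i →
  subst₂ (λ a b → a ≢ bot → a ≡ b) (lookup-map i _ (cols ρ)) (lookup-map i _ (cols ρ)) (s i)
sat⇒satC (pre x y) ρ s rewrite row-cols ρ x | row-cols ρ y =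
  subst₂ _≤_ (countBot-row (cols ρ) y) (countBot-row (cols ρ) x) s
sat⇒satC (eq x y) ρ s rewrite row-cols ρ x | row-cols ρ y = map-≡⁻ (cols ρ) s
sat⇒satC (neg φ) ρ s = s ∘ satC⇒sat φ ρ
sat⇒satC (conj φ ψ) ρ (s , t) = sat⇒satC φ ρ s , sat⇒satC ψ ρ t
sat⇒satC (disj φ ψ) ρ (inj₁ s) = inj₁ (sat⇒satC φ ρ s)
sat⇒satC (disj φ ψ) ρ (inj₂ s) = inj₂ (sat⇒satC ψ ρ s)
sat⇒satC (ex φ) ρ (e , s) = _ , map-tail-zipWith e (cols ρ) , sat⇒satC φ (e ∷ ρ) s
sat⇒satC (all φ) ρ s ws p with e , refl ← unzip-tail (cols ρ) ws p = sat⇒satC φ (e ∷ ρ) (s e)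

satC⇒sat (sub x y) ρ s rewrite row-cols ρ x | row-cols ρ y = λ i →
  subst₂ (λ a b → a ≢ bot → a ≡ b) (sym (lookup-map i _ (cols ρ))) (sym (lookup-map i _ (cols ρ)))
    (all-toList⁻ {P = SubAt x y} (cols ρ) s i)
satC⇒sat (pre x y) ρ s rewrite row-cols ρ x | row-cols ρ y =
  subst₂ _≤_ (sym (countBot-row (cols ρ) y)) (sym (countBot-row (cols ρ) x)) s
satC⇒sat (eq x y) ρ s rewrite row-cols ρ x | row-cols ρ y = map-≡⁺ (cols ρ) s
satC⇒sat (neg φ) ρ s = s ∘ sat⇒satC φ ρ
satC⇒sat (conj φ ψ) ρ (s , t) = satC⇒sat φ ρ s , satC⇒sat ψ ρ t
satC⇒sat (disj φ ψ) ρ (inj₁ s) = inj₁ (satC⇒sat φ ρ s)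
satC⇒sat (disj φ ψ) ρ (inj₂ s) = inj₂ (satC⇒sat ψ ρ s)
satC⇒sat (ex φ) ρ (ws , p , s) with e , refl ← unzip-tail (cols ρ) ws p = e , satC⇒sat φ (e ∷ ρ) s
satC⇒sat (all φ) ρ s e = satC⇒sat φ (e ∷ ρ) (s _ (map-tail-zipWith e (cols ρ)))

-- Reading the input

-- A consumed symbol becomes `gone` instead of being cut out, which keeps the tape length, and with
-- it all time bounds, fixed.
data Letter (B : Set) : Set where
  raw    : Sym → Letter B
  gone   : Letter B
  column : B → Letter B

Letter-finite : Finite B → Finite (Letter B)
Letter-finite fin = surjection-finite
  [ raw , maybe′ column gone ]′
  (λ { (raw s) → inj₁ s ; gone → inj₂ nothing ; (column b) → inj₂ (just b) })
  (λ { (raw s) → refl ; gone → refl ; (column b) → refl })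
  (⊎-finite Sym-finite (Maybe-finite fin))

columnLetterₑ : Emb B (Letter B)
columnLetterₑ = record
  { emb      = column
  ; view     = λ { (raw _) → nothing ; gone → nothing ; (column b) → just b }
  ; view-emb = λ _ → refl }

-- This is Alph 0 (k + m), arranged so that no transport along +-suc is needed.
Total : ℕ → ℕ → Set
Total zero    m = Alph 0 m
Total (suc k) m = Total k (suc m)

Total-finite : ∀ k m → Finite (Total k m)
Total-finite zero    m = Alph-finite 0 m
Total-finite (suc k) m = Total-finite k (suc m)

arityₑ : ∀ k m → Emb (Alph k m) (Letter (Total k m))
arityₑ zero    m = columnLetterₑ
arityₑ (suc k) m = arityₑ k (suc m) ∘ₑ deeperₑ

raw-blind : ∀ k m s → Blind (arityₑ k m) (raw s)
raw-blind zero    m s = refl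
raw-blind (suc k) m s = blind-∘ₑ (arityₑ k (suc m)) deeperₑ (raw-blind k (suc m) s)

gone-blind : ∀ k m → Blind (arityₑ k m) gone
gone-blind zero    m = refl
gone-blind (suc k) m = blind-∘ₑ (arityₑ k (suc m)) deeperₑ (gone-blind k (suc m))

module _ {g : St → A → St × A} where

  accumR-++ : ∀ xs {s s₁ s₂ ys xs' ys'} → mapAccumR g s ys ≡ (s₁ , ys') → mapAccumR g s₁ xs ≡ (s₂ , xs') →
    mapAccumR g s (xs ++ ys) ≡ (s₂ , xs' ++ ys')
  accumR-++ []       e refl = e
  accumR-++ (x ∷ xs) e refl rewrite accumR-++ xs e refl = refl

  accumR-∷ : ∀ {x y s s₁ s₂ ys ys'} → mapAccumR g s ys ≡ (s₁ , ys') → g s₁ x ≡ (s₂ , y) →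
    mapAccumR g s (x ∷ ys) ≡ (s₂ , y ∷ ys')
  accumR-∷ e e' rewrite e | e' = refl

  accumR-fixed : ∀ {s xs} → All (λ a → g s a ≡ (s , a)) xs → mapAccumR g s xs ≡ (s , xs)
  accumR-fixed []       = refl
  accumR-fixed (p ∷ ps) = accumR-∷ (accumR-fixed ps) p

  length-mapAccumR : ∀ s w → length (proj₂ (mapAccumR g s w)) ≡ length w
  length-mapAccumR s []      = refl
  length-mapAccumR s (x ∷ w) = cong suc (length-mapAccumR s w)

mapAccumL-idle : (s : St) (w : List A) → mapAccumL idle s w ≡ (s , w)
mapAccumL-idle s [] = refl
mapAccumL-idle s (x ∷ w) rewrite mapAccumL-idle s w = refl

runs-sweepR : (fin : Finite St) (g : St → A → St × A) → ∀ {s w s' w'} → mapAccumR g s w ≡ (s' , w') →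
  Runs (sweep fin idle g s) w (passTime (length w)) s' w'
runs-sweepR fin g {s} {w} e = subst (λ r → Runs (sweep fin idle g s) w (passTime (length w)) (proj₁ r) (proj₂ r))
  (trans (cong (λ r → mapAccumR g (proj₁ r) (proj₂ r)) (mapAccumL-idle s w)) e) (runs-sweep fin idle g s w)

map-∷ʳ-++ : (f : A → B) → ∀ xs {x zs} → map f (xs ∷ʳ x) ++ zs ≡ map f xs ++ f x ∷ zs
map-∷ʳ-++ f []       = refl
map-∷ʳ-++ f (x ∷ xs) = cong (f x ∷_) (map-∷ʳ-++ f xs)

data Phase : Set where
  seek     : Phase
  carry    : Val → Phase
  placed   : Phase
  finished : Phase

Phase-finite : Finite Phase
Phase-finite = seek ∷ placed ∷ finished ∷ map carry (proj₁ Val-finite) ,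
  λ { seek → here refl ; placed → there (here refl) ; finished → there (there (here refl))
    ; (carry v) → there (there (there (∈-map⁺ carry (proj₂ Val-finite v)))) }

module _ (E : Emb (Alph k (suc m)) (Letter B)) (blind : ∀ s → Blind E (raw s)) where

  private
    place : Val → Letter B → Maybe (Alph k (suc m)) → Phase × Letter B
    place v a (just (col u _)) = placed , emb E (deeper (col (v ∷ u) false))
    place v a _                = carry v , a

    -- In a sweep to the left, the last remaining symbol of the input is deleted and, if it is a
    -- value, added to the last column that has not yet received a value.
    pull : Phase → Letter B → Phase × Letter B
    pull seek      (raw s0)  = carry v0 , gone
    pull seek      (raw s1)  = carry v1 , gone
    pull seek      (raw s⊥)  = carry bot , gone
    pull seek      (raw sep) = finished , gone
    pull seek      a         = seek , a
    pull (carry v) a         = place v a (view E a)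
    pull placed    a         = placed , a
    pull finished  a         = finished , a

    again : Phase → Mach (Letter B) (Maybe ⊤)
    again placed = ret nothing
    again _      = ret (just tt)

    body : Mach (Letter B) (Maybe ⊤)
    body = bind Phase-finite (sweep Phase-finite idle pull seek) again

    old : Vec Val k → Letter B
    old u = emb E (col u false)

    new : Vec Val (suc k) → Letter B
    new u = emb E (deeper (col u false))

    -- The shape of the tape while a row is attached: columns still waiting, columns already
    -- extended, unread input, deleted cells.
    word : List (Vec Val k) → List (Vec Val (suc k)) → List Sym → ℕ → List (Letter B)
    word us ds ss r = map old us ++ (map new ds ++ (map raw ss ++ replicate r gone))

    pull-val : ∀ v → pull seek (raw (encVal v)) ≡ (carry v , gone)
    pull-val v0  = refl
    pull-val v1  = refl
    pull-val bot = refl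

    gone-fixed : ∀ r → mapAccumR pull seek (replicate r gone) ≡ (seek , replicate r gone)
    gone-fixed r = accumR-fixed (replicate⁺ r refl)

    raw-fixed : ∀ v ss → mapAccumR pull (carry v) (map raw ss) ≡ (carry v , map raw ss)
    raw-fixed v ss = accumR-fixed (map⁺ (All.universal (λ s → cong (place v (raw s)) (blind s)) ss))

    new-fixed : ∀ v ds → mapAccumR pull (carry v) (map new ds) ≡ (carry v , map new ds)
    new-fixed v ds = accumR-fixed (map⁺ (All.universal (λ u → cong (place v (new u)) (view-emb E _)) ds))

    pull-value : ∀ us u ds ss v r →
      mapAccumR pull seek (word (us ∷ʳ u) ds (ss ∷ʳ encVal v) r) ≡ (placed , word us ((v ∷ u) ∷ ds) ss (suc r))
    pull-value us u ds ss v r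
      rewrite map-∷ʳ-++ old us {u} {map new ds ++ (map raw (ss ∷ʳ encVal v) ++ replicate r gone)}
            | map-∷ʳ-++ (raw {B}) ss {encVal v} {replicate r gone}
      = accumR-++ (map old us)
          (accumR-∷ (accumR-++ (map new ds) (accumR-++ (map raw ss) (accumR-∷ (gone-fixed r) (pull-val v)) (raw-fixed v ss))
                      (new-fixed v ds))
            (cong (place v (old u)) (view-emb E _)))
          (accumR-fixed (All.universal (λ _ → refl) _))

    pull-sep : ∀ ds ss r →
      mapAccumR pull seek (word [] ds (ss ∷ʳ sep) r) ≡ (finished , word [] ds ss (suc r))
    pull-sep ds ss r rewrite map-∷ʳ-++ (raw {B}) ss {sep} {replicate r gone} =
      accumR-++ (map new ds) (accumR-++ (map raw ss) (accumR-∷ (gone-fixed r) refl)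
          (accumR-fixed (All.universal (λ _ → refl) _)))
        (accumR-fixed (All.universal (λ _ → refl) _))

    vals : List (Vec Val (suc k)) → List Sym
    vals = map (encVal ∘ head)

    bodyTime : ℕ → ℕ
    bodyTime n = passTime n + 1

  attach : Mach (Letter B) ⊤
  attach = loop body

  private
    length-word : ∀ {ph w w' N} → length w ≡ N → mapAccumR pull seek w ≡ (ph , w') → length w' ≡ N
    length-word {w = w} l e = trans (cong (length ∘ proj₂) (sym e)) (trans (length-mapAccumR seek w) l)

    runs-body : ∀ {w ph w' x N} → length w ≡ N → mapAccumR pull seek w ≡ (ph , w') → again ph ≡ ret x →
      Runs body w (bodyTime N) x w'
    runs-body refl e e' = runs-bind Phase-finite _ again (runs-sweepR Phase-finite pull e)
      (subst (λ M → Runs M _ 1 _ _) (sym e') (runs-ret _ _))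

  -- Values are taken from the end of the input, so the induction follows the reverse view. The
  -- round beyond `length ps` removes the separator and ends the loop.
  runs-attach : ∀ {ps} → Reverse ps → ∀ ds ss r {N} → let w = word (map tail ps) ds (ss ++ sep ∷ vals ps) r in
    length w ≡ N → ∃ λ r' → let w' = word [] (ps ++ ds) ss r' in
    Runs attach w (suc (length ps) * bodyTime N) tt w' × length w' ≡ N
  runs-attach [] ds ss r l = suc r ,
    runs-loop-done body (runs-weaken (m≤m+n _ 0) (runs-body l (pull-sep ds ss r) refl)) ,
    length-word l (pull-sep ds ss r)
  runs-attach (qs ∶ rs ∶ʳ (v ∷ u)) ds ss r {N} l
    rewrite map-++ tail qs ((v ∷ u) ∷ []) | map-++ (encVal ∘ head) qs ((v ∷ u) ∷ [])
          | sym (++-assoc ss (sep ∷ vals qs) (encVal v ∷ []))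
          | ∷ʳ-++ qs (v ∷ u) ds
          | length-++ qs {(v ∷ u) ∷ []} | +-comm (length qs) 1
    = let e = pull-value (map tail qs) u ds (ss ++ sep ∷ vals qs) v r
          r' , run , l' = runs-attach rs ((v ∷ u) ∷ ds) ss (suc r) (length-word l e)
      in r' , runs-loop-again body (runs-body l e refl) run , l'

  runs-attach-row : ∀ {n} (e : PInst n) (us : Vec (Vec Val k) n) ss r {N} →
    let w = word (toList us) [] (ss ++ sep ∷ encPInst e) r in
    length w ≡ N → ∃ λ r' → let w' = word [] (toList (zipWith _∷_ e us)) ss r' in
    Runs attach w (suc N * bodyTime N) tt w' × length w' ≡ N
  runs-attach-row e us ss r {N} l rewrite sym (map-tail-zipWith e us) | sym (map-head-zipWith e us) =
    subst (λ qs → ∃ λ r' → Runs attach w (suc N * bodyTime N) tt (word [] qs ss r') × length (word [] qs ss r') ≡ N)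
      (++-identityʳ ps)
      (let r' , run , l' = runs-attach (reverseView ps) [] ss r l
       in r' , runs-weaken (*-monoˡ-≤ (bodyTime N) (s≤s length-ps)) run , l')
    where
    ps : List (Vec Val (suc k))
    ps = toList (zipWith _∷_ e us)

    w : List (Letter B)
    w = word (map tail ps) [] (ss ++ sep ∷ vals ps) r

    length-ps : length ps ≤ N
    length-ps = subst₂ _≤_ (trans (length-map old (map tail ps)) (length-map tail ps))
      (trans (sym (length-++ (map old (map tail ps)))) l) (m≤m+n _ _)

-- Only the symbols before the first separator encode the dimension. From there on the state is
-- `false`, so the later `s1`s, of tree indices and instances, are left alone.
begin : Bool → Letter (Alph 0 m) → Bool × Letter (Alph 0 m)
begin true (raw s1) = true , column (col [] false)
begin _    a        = false , a

-- The input is consumed from its end, so the last instance is attached first and each earlier one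
-- goes in front, the order in which `cols` adds rows.
parse : ∀ k m → Mach (Letter (Total k m)) ⊤
parse zero    m = bind Bool-finite (sweep Bool-finite begin idle true) (λ _ → ret tt)
parse (suc k) m = bind ⊤-finite (parse k (suc m)) (λ _ → attach (arityₑ k (suc m)) (raw-blind k (suc m)))

parseTime : ℕ → ℕ → ℕ
parseTime zero    n = passTime n + 1
parseTime (suc k) n = parseTime k n + suc n * (passTime n + 1)

poly-parseTime : ∀ k → Poly (parseTime k)
poly-parseTime zero    = poly-+ poly-passTime (poly-const 1)
poly-parseTime (suc k) = poly-+ (poly-parseTime k)
  (poly-* (poly-+ (poly-const 1) poly-id) (poly-+ poly-passTime (poly-const 1)))

parsed : ∀ {n} k m → List Sym → Vec (PInst n) k → ℕ → List (Letter (Total k m))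
parsed k m ss es r = map (λ u → emb (arityₑ k m) (col u false)) (toList (cols es)) ++ (map raw ss ++ replicate r gone)

mapAccumL-begin : ∀ n ss → mapAccumL (begin {m}) true (map raw (unary n ++ sep ∷ ss)) ≡
  (false , map (λ u → column (col u false)) (toList (Vec.replicate n [])) ++ map raw (sep ∷ ss))
mapAccumL-begin (suc n) ss = cong (λ r → proj₁ r , _ ∷ proj₂ r) (mapAccumL-begin n ss)
mapAccumL-begin zero ss = cong (λ r → proj₁ r , raw sep ∷ proj₂ r) (stop ss)
  where
  stop : ∀ ss → mapAccumL begin false (map raw ss) ≡ (false , map raw ss)
  stop []       = refl
  stop (s ∷ ss) rewrite stop ss = refl

-- `ss` is arbitrary rather than the code of a tree: until the later instances have been read, the
-- encoding of `e` counts as part of it.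
runs-parse : ∀ {n} k m ss (es : Vec (PInst n) k) → let w = map raw (unary n ++ (sep ∷ ss) ++ encPInsts es) in
  ∃ λ r → let w' = parsed k m (sep ∷ ss) es r in
  Runs (parse k m) w (parseTime k (length w)) tt w' × length w' ≡ length w
runs-parse {n} zero m ss [] rewrite ++-identityʳ ss =
  let w  = map raw (unary n ++ sep ∷ ss)
      e  = trans (cong (λ r → mapAccumR idle (proj₁ r) (proj₂ r)) (mapAccumL-begin n ss)) (mapAccumR-idle _ _)
      e' = cong (map (λ u → column (col u false)) (toList (Vec.replicate n [])) ++_) (sym (++-identityʳ (map raw (sep ∷ ss))))
  in 0 ,
     subst (Runs (parse zero m) _ _ tt) e'
       (runs-bind Bool-finite _ (λ _ → ret tt)
         (subst (λ r → Runs (sweep Bool-finite begin idle true) w (passTime (length w)) (proj₁ r) (proj₂ r)) e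
           (runs-sweep Bool-finite begin idle true w)) (runs-ret tt _)) ,
     trans (cong length (sym e')) (trans (cong (length ∘ proj₂) (sym (mapAccumL-begin n ss)))
       (length-mapAccumL begin true (map raw (unary n ++ sep ∷ ss))))
runs-parse (suc k) m ss (e ∷ es) rewrite sym (++-assoc ss (sep ∷ encPInst e) (encPInsts es)) =
  let r , run , l = runs-parse k (suc m) (ss ++ sep ∷ encPInst e) es
      r' , run' , l' = runs-attach-row (arityₑ k (suc m)) (raw-blind k (suc m)) e (cols es) (sep ∷ ss) r l
  in r' , runs-bind ⊤-finite (parse k (suc m)) _ run run' , l'

-- The initial tape and the final assembly

mark : Mach A ⊤
mark = record { State = ⊤ ; finite = ⊤-finite ; start = tt ; δ = λ
  { _ nothing        → nothing , S , inj₂ tt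
  ; _ (just (_ , a)) → just (true , a) , S , inj₂ tt } }

-- The sweep changes no letter; its excursion to the right end leaves the one blank that `onTape`
-- expects behind the input.
prelude : Mach A ⊤
prelude = bind ⊤-finite mark (λ _ → sweep ⊤-finite idle idle tt)

initTape : List A → Tape A
initTape []       = tape [] nothing []
initTape (x ∷ xs) = tape [] (plain x) (map plain xs)

exec-prelude : (w : List A) → ∃ λ t → t ≤ 1 + passTime (length w) ×
  Exec prelude (inj₁ tt) (initTape w) t tt (onTape w)
exec-prelude [] = 3 , ≤-refl , exec-bind ⊤-finite mark _ (exit refl) (next refl (exit refl))
exec-prelude (x ∷ xs) =
  let t , p , r = exec-sweep ⊤-finite idle idle (inj₁ refl) tt x xs
      e = trans (cong (λ r → mapAccumR idle (proj₁ r) (proj₂ r)) (mapAccumL-idle tt (x ∷ xs))) (mapAccumR-idle tt (x ∷ xs))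
  in suc t , s≤s p , exec-bind ⊤-finite mark _ (exit refl)
       (subst₂ (λ rs v → Exec (sweep ⊤-finite idle idle tt) (inj₁ tt) (tape [] (just (true , x)) rs) t tt (onTape v))
         (++-identityʳ (map plain xs)) (cong proj₂ e) r)

module _ (finA : Finite A) (input : Sym → A) (M : Mach A Bool) where

  private
    N : Mach A Bool
    N = bind ⊤-finite prelude (λ _ → M)

  initConfig-toTM : ∀ w → initConfig (toTM finA input N) w ≡ encConfig finA input N (start N) (initTape (map input w))
  initConfig-toTM []      = refl
  initConfig-toTM (x ∷ w) = cong (conf _ [] _) (trans (map-∘ w) (map-∘ (map input w)))

  runs⇒halts : ∀ w {T b w'} t → Runs M (map input w) T b w' → 1 + passTime (length w) + T ≤ t →
    run (toTM finA input N) t (running (initConfig (toTM finA input N) w)) ≡ halted b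
  runs⇒halts w {T} t (runs p r) bound with t' , p' , r' ← exec-prelude (map input w)
    rewrite initConfig-toTM w | length-map input w
    = run-halted (toTM finA input N) _ _ (≤-trans (+-mono-≤ p' p) bound)
        (run-toTM finA input N (exec-bind ⊤-finite prelude (λ _ → M) r' r))

  evalInP : (φ : Formula k) {T : ℕ → ℕ} → Poly (λ n → 1 + passTime n + T n) →
    (∀ {n} (t : DTree n) (es : Vec (PInst n) k) → ∃ λ b → ∃ λ w' →
      Runs M (map input (encInput t es)) (T (length (encInput t es))) b w' × Reflects (Sat φ es) b) →
    EvalInP φ
  evalInP φ (c , bound) correct =
    toTM finA input N , c , λ n t _ es → let b , _ , r , reflects = correct t es in
    b , runs⇒halts (encInput t es) _ r (bound _) , reflects⇔ reflects
    where
    reflects⇔ : ∀ {P : Set} {b} → Reflects P b → (b ≡ true) ⇔ P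
    reflects⇔ (ofʸ p)  = mk⇔ (λ _ → p) (λ _ → refl)
    reflects⇔ (ofⁿ ¬p) = mk⇔ (λ ()) (λ p → ⊥-elim (¬p p))

theorem3 : (k : ℕ) (φ : Formula k) → EvalInP φ
theorem3 k φ = evalInP (Letter-finite (Total-finite k d)) raw (bind ⊤-finite (parse k d) evaluate) φ
  (poly-+ (poly-+ (poly-const 1) poly-passTime) (poly-+ (poly-parseTime k) (poly D)))
  λ t es →
    let ss = sep ∷ encTree t
        r , parse-run , l = runs-parse k d (encTree t) es
        b , eval-run , reflects = evaluates es ss r l
    in b , parsed k d ss es r ,
       subst (λ n → Runs _ (map raw (encInput t es)) (parseTime k n + time D n) b (parsed k d ss es r))
         (length-map raw (encInput t es))
         (runs-bind ⊤-finite (parse k d) evaluate parse-run eval-run) ,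
       reflects-map (satC⇒sat φ es) (sat⇒satC φ es) reflects
  where
  d : ℕ
  -- Along a branch of `φ` at most `d` rows are added to the `k` given ones, so the alphabet must
  -- provide arities up to `k + d`.
  d = depth φ

  D : Decides (arityₑ k d) Always (SatC φ)
  D = decides-satC (arityₑ k d) φ ≤-refl

  evaluate : ⊤ → Mach (Letter (Total k d)) Bool
  evaluate _ = machine D

  evaluates : ∀ {n} (es : Vec (PInst n) k) ss r {N} → length (parsed k d ss es r) ≡ N → ∃ λ b →
    Runs (machine D) (parsed k d ss es r) (time D N) b (parsed k d ss es r) × Reflects (SatC φ (toList (cols es))) b
  evaluates es ss r {N} l =
    let us = toList (cols es)
        junk = map raw ss ++ replicate r gone
        b , w , reflects = correct D us tt
        columns≡ = sym (map-∘ {g = emb (arityₑ k d)} {f = emb columnₑ} us)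
        length≡ = trans (cong (_+ length junk) (trans (length-map (emb columnₑ) us) (sym (length-map _ us))))
          (trans (sym (length-++ (map (λ u → emb (arityₑ k d) (col u false)) us))) l)
    in b ,
       subst₂ (λ v n → Runs (machine D) (v ++ junk) (time D n) b (v ++ junk)) columns≡ length≡
         (Works.correctly w junk (++⁺ (map⁺ (All.universal (raw-blind k d) ss)) (replicate⁺ r (gone-blind k d)))) ,
       reflects
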